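{- Let $G=(V,E)$ be a directed graph, let $H$ be a maximal eulerian subgraph of $G$, and let $r:V\to\mathbb{Z}$ be a rank function conforming $H$. Assume that there is an edge $(p,s)\in E(H)$ with $\mathrm{slack}((p,s),r)>0$, and let $(H',r')$ be the output of $\mathrm{Relief}(H,r,G,p,s)$. Then $H'$ is a maximal eulerian subgraph of $G$, $r'$ conforms $H'$, $$\max_{e\in E(H')}\mathrm{slack}(e,r')\le\max_{e\in E(H)}\mathrm{slack}(e,r),$$ and $$\left|\{e\in E(H') : \mathrm{slack}(e,r')>0\}\right|<\left|\{e\in E(H) : \mathrm{slack}(e,r)>0\}\right|.$$
   Context: Graphs are finite and directed; subgraphs of $G=(V,E)$ are taken on the same vertex set $V$, and $E(H)$ is the edge set of $H$. A rank function is a map $r:V\to\mathbb{Z}$. An edge $(u,v)$ is forward w.r.t. $r$ if $r(u)<r(v)$ and backward if $r(u)\ge r(v)$. Slack: $\mathrm{slack}((u,v),r)=\max(r(v)-r(u)-1,0)$. A graph is eulerian if every vertex has in-degree equal to out-degree (connectivity is not required). A subgraph $H$ of $G$ is a maximal eulerian subgraph if it is eulerian and no eulerian subgraph of $G$ has an edge set strictly containing $E(H)$. A rank function $r$ conforms $H$ if all edges of $G$ that are backward w.r.t. $r$ lie in $E(H)$. Algorithm Relief$(H,r,G,p,s)$. Input: a graph $G=(V,E)$, a maximal eulerian subgraph $H$, a rank function $r$ conforming $H$, and an edge $(p,s)\in E(H)$ with $\mathrm{slack}((p,s),r)>0$. (1) Set $F:=E(H)$, $r':=r$, $t(v):=0$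 for all $v\in V$; then set $t(p):=r(s)-r(p)-1$ and let $S$ be a priority queue (largest priority first) containing only $p$, with priority $t(p)$. (2) While $S$ is not empty: pop a vertex $u$ of highest priority from $S$ and set $r'(u):=r'(u)+t(u)$. For each $(u,v)\in E\setminus F$ with $r'(v)\le r'(u)$: let $t:=r'(u)+1-r'(v)$; if $t>t(v)$, set $t(v):=t$, add $v$ to $S$ with priority $t$ (updating its priority if $v$ is already in $S$), and set $\mathrm{parent}(v):=u$. Then for each $e=(w,u)\in F$ with $\mathrm{slack}(e,r')>\mathrm{slack}(e,r)$: let $t:=\mathrm{slack}(e,r')-\mathrm{slack}(e,r)$; if $t>t(w)$, set $t(w):=t$, add $w$ to $S$ with priority $t$ (updating its priority if $w$ is already in $S$), and set $\mathrm{parent}(w):=u$. (3) After the loop, if $\mathrm{slack}((p,s),r')>0$: let $O$ be the set of edges of $E$ along the path from $s$ to $p$ obtained by following the parent links (for each vertex $x\ne p$ on this path, the edge joining $x$ and $\mathrm{parent}(x)$ is the one that was being processed when $\mathrm{parent}(x)$ was last set); replace $F$ by $(F\setminus O)\cup(O\setminus F)$ and then delete $(p,s)$ from $F$. (4) Return $H'=(V,F)$ and $r'$. -}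

module Defs where

open import Data.Bool using (Bool; T; T?; _∧_; _∨_; not; if_then_else_)
open import Data.Fin using (Fin; _≟_)
open import Data.Integer using (ℤ; 0ℤ; 1ℤ; _+_; _-_; _⊔_; _≤_; _≥_; _>_)
open import Data.Integer.Properties using (≤-totalOrder; _≤?_; _<?_)
open import Data.List using (List; []; _∷_; allFin; cartesianProduct; filter; foldl; length; map)
open import Data.List.Extrema ≤-totalOrder using (max)
import Data.List.Membership.DecPropositional as DecMembership
open import Data.List.Relation.Binary.Permutation.Propositional using (_↭_)
open import Data.Maybe using (Maybe; just; nothing)
open import Data.Nat using (ℕ)
open import Data.Product using (∃; ∃₂; _×_; _,_)
open import Data.Product.Properties using (≡-dec)
open import Data.Vec.Functional using (updateAt)
open import Function using (flip; const)
open import Induction.WellFounded using (Acc)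
open import Relation.Binary using (DecidableEquality)
open import Relation.Binary.Construct.Closure.ReflexiveTransitive using (Star)
open import Relation.Binary.PropositionalEquality using (_≡_; _≢_)
open import Relation.Nullary using (¬_; does; _×-dec_)

Edge : ℕ → Set
Edge n = Fin n × Fin n

_≟ᵉ_ : ∀ {n} → DecidableEquality (Edge n)
_≟ᵉ_ = ≡-dec _≟_ _≟_

-- A graph on the vertex set Fin n is its edge set, an arbitrary subset of
-- Fin n × Fin n (self-loops are allowed).
Graph : ℕ → Set
Graph n = Edge n → Bool

Rank : ℕ → Set
Rank n = Fin n → ℤ

module _ {n : ℕ} where

  infix  4 _∈_ _∉_ _⊆_ _⊂_
  infixl 6 _∖_ _∪_

  _∈_ _∉_ : Edge n → Graph n → Set
  e ∈ G = T (G e)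
  e ∉ G = ¬ (e ∈ G)

  _⊆_ _⊂_ : Graph n → Graph n → Set
  H ⊆ K = ∀ e → e ∈ H → e ∈ K
  H ⊂ K = H ⊆ K × ∃ λ e → e ∈ K × e ∉ H

  _∖_ _∪_ : Graph n → Graph n → Graph n
  (F ∖ O) e = F e ∧ not (O e)
  (F ∪ O) e = F e ∨ O e

  fromList : List (Edge n) → Graph n
  fromList es e = does (e ∈? es)
    where open DecMembership _≟ᵉ_ using (_∈?_)

  edges : Graph n → List (Edge n)
  edges G = filter (λ e → T? (G e)) (cartesianProduct (allFin n) (allFin n))

  outDegree inDegree : Graph n → Fin n → ℕ
  outDegree G v = length (filter (λ w → T? (G (v , w))) (allFin n))
  inDegree  G v = length (filter (λ u → T? (G (u , v))) (allFin n))

  Eulerian : Graph n → Set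
  Eulerian G = ∀ v → inDegree G v ≡ outDegree G v

  MaximalEulerian : (G H : Graph n) → Set
  MaximalEulerian G H =
    H ⊆ G × Eulerian H × ¬ (∃ λ K → K ⊆ G × Eulerian K × H ⊂ K)

  Backward : Rank n → Edge n → Set
  Backward r (u , v) = r u ≥ r v

  Conforms : (G : Graph n) → Rank n → (H : Graph n) → Set
  Conforms G r H = ∀ e → e ∈ G → Backward r e → e ∈ H

  slack : Edge n → Rank n → ℤ
  slack (u , v) r = (r v - r u - 1ℤ) ⊔ 0ℤ

  -- Slacks are nonnegative, so the default value 0ℤ is the maximum only if
  -- there are no edges or all slacks vanish.
  maxSlack : Graph n → Rank n → ℤ
  maxSlack H r = max 0ℤ (map (λ e → slack e r) (edges H))

  slackEdgeCount : Graph n → Rank n → ℕ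
  slackEdgeCount H r = length (filter (λ e → 0ℤ <? slack e r) (edges H))

-- The order in which the edges at a vertex are scanned and the choice among
-- queued vertices of equal priority are left open by the algorithm, so it is
-- a nondeterministic transition system; one step is one iteration of the
-- while loop.
module Relief {n : ℕ} (H : Graph n) (r : Rank n) (G : Graph n) (p s : Fin n) where

  -- F does not change inside the while loop and equals H there.

  record State : Set where
    field
      rank   : Rank n                         -- r'
      t      : Fin n → ℤ
      queue  : Fin n → Maybe ℤ                -- priority, if queued
      parent : Fin n → Maybe (Fin n × Edge n) -- with the edge processed when it was set

  open State

  init : State
  init = record
    { rank   = r
    ; t      = updateAt (const 0ℤ) p (const t₀)
    ; queue  = updateAt (const nothing) p (const (just t₀))
    ; parent = const nothing
    }
    where
    t₀ : ℤ
    t₀ = r s - r p - 1ℤ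

  popRaise : Fin n → State → State
  popRaise u σ = record σ
    { rank  = updateAt (rank σ) u (_+ t σ u)
    ; queue = updateAt (queue σ) u (const nothing)
    }

  -- offer u e v k: while u is processed, edge e asks for v to be raised by k.
  offer : Fin n → Edge n → Fin n → ℤ → State → State
  offer u e v k σ =
    if does (t σ v <? k)
    then record σ
      { t      = updateAt (t σ) v (const k)
      ; queue  = updateAt (queue σ) v (const (just k))
      ; parent = updateAt (parent σ) v (const (just (u , e)))
      }
    else σ

  scanOut scanIn : Fin n → State → Fin n → State
  scanOut u σ v = offer u (u , v) v (rank σ u + 1ℤ - rank σ v) σ
  scanIn  u σ w = offer u (w , u) w (slack (w , u) (rank σ) - slack (w , u) r) σ

  -- The conditions are evaluated for the rank r' given as an argument; the
  -- scans themselves leave r' unchanged.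
  violatedOut violatedIn : Fin n → Rank n → List (Fin n)
  violatedOut u r′ =
    filter (λ v → T? ((G ∖ H) (u , v)) ×-dec (r′ v ≤? r′ u)) (allFin n)
  violatedIn u r′ =
    filter (λ w → T? (H (w , u)) ×-dec (slack (w , u) r <? slack (w , u) r′)) (allFin n)

  data _⟶_ (σ : State) : State → Set where
    pop : ∀ u k → queue σ u ≡ just k →
          (∀ v l → queue σ v ≡ just l → l ≤ k) →
          let σ′ = popRaise u σ in
          ∀ vs ws → vs ↭ violatedOut u (rank σ′) → ws ↭ violatedIn u (rank σ′) →
          σ ⟶ foldl (scanIn u) (foldl (scanOut u) σ′ vs) ws

  _⟶*_ : State → State → Set
  _⟶*_ = Star _⟶_

  Finished : State → Set
  Finished σ = ∀ v → queue σ v ≡ nothing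

  -- ParentPath σ x es: following the parent links from x leads to p along es.
  data ParentPath (σ : State) : Fin n → List (Edge n) → Set where
    here : ParentPath σ p []
    step : ∀ {x u e es} → x ≢ p → parent σ x ≡ just (u , e) →
           ParentPath σ u es → ParentPath σ x (e ∷ es)

  reroute : List (Edge n) → Graph n
  reroute es = ((H ∖ O) ∪ (O ∖ H)) ∖ fromList ((p , s) ∷ [])
    where
    O : Graph n
    O = fromList es

  data Exit (σ : State) : Graph n → Rank n → Set where
    noSlack : ¬ (slack (p , s) (rank σ) > 0ℤ) → Exit σ H (rank σ)
    slackLeft : ∀ {es} → slack (p , s) (rank σ) > 0ℤ → ParentPath σ s es →
                Exit σ (reroute es) (rank σ)

  OutputFrom : State → Graph n → Rank n → Set
  OutputFrom σ H′ r′ = ∃ λ σ′ → σ ⟶* σ′ × Finished σ′ × Exit σ′ H′ r′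

  Output : Graph n → Rank n → Set
  Output = OutputFrom init

  -- No run is infinite, and no run gets stuck before delivering an output.
  Terminates : Set
  Terminates =
    Acc (flip _⟶_) init × (∀ σ → init ⟶* σ → ∃₂ (OutputFrom σ))

{-# OPTIONS --safe #-}

-- Relief is Dijkstra's algorithm on residual edges: every request made while u
-- is processed is at most t(u), and a vertex already raised received at least
-- as much, so it never needs to move again. Hence each vertex is raised at
-- most once, and the final rank makes all edges outside H forward without
-- increasing any slack in H. On the parent path from s to p, the edges outside
-- H have slack 0 and the edges of H are forward; exchanging them and dropping
-- (p , s) is an exchange along a closed residual walk, so it preserves
-- eulerianity. Any eulerian subgraph that a rank conforms to is maximal, since
-- a further eulerian edge set would consist of forward edges only.

module Submission where

open import Defs
open import Data.Bool using (Bool; true; false; T; T?; if_then_else_; not)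
open import Data.Bool.Properties using (∧-identityʳ)
open import Data.Fin using (Fin; zero; suc; _≟_)
open import Data.Fin.Properties using (punchInᵢ≢i)
open import Data.Integer using (ℤ; 0ℤ; 1ℤ; _+_; _-_; -_; _*_; _≤_; _>_; _⊔_)
  renaming (+_ to pos; _<_ to _<ᶻ_)
open import Data.Integer.Properties hiding (_≟_)
open import Data.Integer.Tactic.RingSolver using (solve-∀)
open import Data.List using (List; []; _∷_; _++_; allFin; cartesianProduct; filter; foldl; length; map; tabulate)
open import Data.List.Extrema ≤-totalOrder using (max[xs]≤max[ys]⁺)
import Data.List.Membership.DecPropositional as DecMembership
open import Data.List.Membership.Propositional using () renaming (_∈_ to _∈ˡ_; _∉_ to _∉ˡ_)
open import Data.List.Membership.Propositional.Properties
  using (∈-filter⁺; ∈-filter⁻; ∈-cartesianProduct⁺; ∈-allFin; ∈-∃++; ∈-++⁻; ∈-++⁺ˡ; ∈-++⁺ʳ)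
open import Data.List.Properties using (length-++)
open import Data.List.Relation.Binary.Permutation.Propositional using (↭-refl; ↭-sym)
open import Data.List.Relation.Binary.Permutation.Propositional.Properties using (∈-resp-↭)
open import Data.List.Relation.Unary.All as All using ()
import Data.List.Relation.Unary.All.Properties as All
open import Data.List.Relation.Unary.AllPairs using ([]; _∷_)
open import Data.List.Relation.Unary.Any as Any using (Any; here; there)
import Data.List.Relation.Unary.Any.Properties as Any
open import Data.List.Relation.Unary.Unique.Propositional using (Unique)
open import Data.List.Relation.Unary.Unique.Propositional.Properties
  using (allFin⁺; filter⁺; cartesianProduct⁺)
open import Data.Maybe using (Maybe; just; nothing)
open import Data.Maybe.Properties using (just-injective)
open import Data.Nat as ℕ using (ℕ; zero; suc; _<_)
open import Data.Nat.Induction using (<-wellFounded)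
import Data.Nat.Properties as ℕ
open import Data.Product using (∃; ∃₂; _×_; _,_; proj₁; proj₂)
open import Data.Sum using (_⊎_; inj₁; inj₂)
open import Data.Unit using (tt)
open import Data.Vec.Functional using (removeAt; updateAt)
open import Data.Vec.Functional.Properties using (updateAt-updates; updateAt-minimal)
open import Function using (_∘_; id; flip; const)
open import Induction.WellFounded using (Acc; acc)
open import Relation.Binary.Construct.Closure.ReflexiveTransitive using (ε; _◅_)
open import Relation.Binary.PropositionalEquality
open import Relation.Nullary using (¬_; Dec; yes; no; does; contradiction; _×-dec_)
open import Relation.Nullary.Decidable using (dec-true; dec-false)
open import Algebra.Properties.Semiring.Sum +-*-semiring
  using (sum; sum-remove; sum-cong-≗; sum-replicate-zero; ∑-comm; ∑-distrib-+; *-distribˡ-sum)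

-- While a vertex waits in the queue, edges between it and raised vertices may be violated for the
-- current ranks. The loop invariants therefore speak of the rank `r v + t v` that each vertex is
-- bound for; it agrees with the current rank once the queue is empty. The start value `t₀` is the
-- raise of `p` that closes the gap of `(p , s)` exactly. If slack remains on this edge at the end,
-- then `s` itself was raised, and the requests behind that raise form the path back to `p`. The
-- algorithm exchanges a set of edges, whereas balance at the vertices is argued along a walk. The
-- two agree because no edge occurs twice on a parent path.

≤-by : ∀ {a b x y} → x ≤ y → b - a ≡ y - x → a ≤ b
≤-by x≤y eq = 0≤i-j⇒j≤i (subst (0ℤ ≤_) (sym eq) (i≤j⇒0≤j-i x≤y))

<-by : ∀ {a b x y} → x <ᶻ y → b - a ≡ y - x → a <ᶻ b
<-by {a} {b} {x} {y} x<y eq =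
  suc[i]≤j⇒i<j (≤-by (i<j⇒suc[i]≤j x<y)
    (trans (shift a b) (trans (cong (_- 1ℤ) eq) (sym (shift x y)))))
  where
  shift : ∀ i j → j - (1ℤ + i) ≡ (j - i) - 1ℤ
  shift = solve-∀

-- Finite sums of integers.

sum-update : ∀ {n} (f g : Fin n → ℤ) i → (∀ j → j ≢ i → f j ≡ g j) →
             sum f ≡ sum g + (f i - g i)
sum-update {suc n} f g i f≈g = begin
  sum f                                ≡⟨ sum-remove {i = i} f ⟩
  f i + sum (removeAt f i)             ≡⟨ cong (f i +_) (sum-cong-≗ (λ j → f≈g _ (punchInᵢ≢i i j))) ⟩
  f i + sum (removeAt g i)             ≡⟨ exchange (f i) (g i) _ ⟩
  g i + sum (removeAt g i) + (f i - g i) ≡⟨ cong (_+ (f i - g i)) (sum-remove {i = i} g) ⟨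
  sum g + (f i - g i)                  ∎
  where
  open ≡-Reasoning
  exchange : ∀ x y z → x + z ≡ y + z + (x - y)
  exchange = solve-∀

sum-nonneg : ∀ {n} (f : Fin n → ℤ) → (∀ i → 0ℤ ≤ f i) → 0ℤ ≤ sum f
sum-nonneg {zero}  f 0≤f = ≤-refl
sum-nonneg {suc n} f 0≤f = +-mono-≤ (0≤f zero) (sum-nonneg (f ∘ suc) (0≤f ∘ suc))

term≤sum : ∀ {n} (f : Fin n → ℤ) → (∀ i → 0ℤ ≤ f i) → ∀ i → f i ≤ sum f
term≤sum f 0≤f zero    =
  subst (_≤ sum f) (+-identityʳ (f zero)) (+-monoʳ-≤ (f zero) (sum-nonneg (f ∘ suc) (0≤f ∘ suc)))
term≤sum f 0≤f (suc i) =
  subst (_≤ sum f) (+-identityˡ (f (suc i))) (+-mono-≤ (0≤f zero) (term≤sum (f ∘ suc) (0≤f ∘ suc) i))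

⟦_⟧ : Bool → ℤ
⟦ b ⟧ = if b then 1ℤ else 0ℤ

length-filter-T : ∀ {A : Set} {n} (f : A → Bool) (g : Fin n → A) →
                  pos (length (filter (λ x → T? (f x)) (tabulate g))) ≡ sum (λ i → ⟦ f (g i) ⟧)
length-filter-T {n = zero}  f g = refl
length-filter-T {n = suc n} f g with f (g zero)
... | true  = cong (1ℤ +_) (length-filter-T f (g ∘ suc))
... | false = trans (length-filter-T f (g ∘ suc)) (sym (+-identityˡ _))

-- Circulations, eulerian subgraphs and maximality.

module _ {n : ℕ} where

  drop-across : (Fin n → ℤ) → Edge n → ℤ
  drop-across φ (a , b) = φ b - φ a

  -- Testing `F` against every potential `φ` replaces the degree equations by a quantity that is
  -- linear in the indicator of `F`. Adding or removing one edge then changes one summand, without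
  -- case distinctions on the vertices affected.
  circulation : Graph n → (Fin n → ℤ) → ℤ
  circulation F φ = sum λ a → sum λ b → ⟦ F (a , b) ⟧ * drop-across φ (a , b)

  circulation-cong : ∀ {F F′} → (∀ e → F e ≡ F′ e) → ∀ φ → circulation F φ ≡ circulation F′ φ
  circulation-cong F≗F′ φ =
    sum-cong-≗ λ a → sum-cong-≗ λ b → cong (λ z → ⟦ z ⟧ * (φ b - φ a)) (F≗F′ (a , b))

  -- Summation by parts: each edge contributes `φ` at its head and `- φ` at its tail, and the
  -- contributions are regrouped by vertex.
  circulation-degrees : ∀ F φ →
    circulation F φ ≡ sum (λ v → φ v * (pos (inDegree F v) - pos (outDegree F v)))
  circulation-degrees F φ = begin
    (sum λ a → sum λ b → x a b * (φ b - φ a))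
      ≡⟨ (sum-cong-≗ λ a → sum-cong-≗ λ b → expand (x a b) (φ b) (φ a)) ⟩
    (sum λ a → sum λ b → φ b * x a b + - φ a * x a b)
      ≡⟨ (sum-cong-≗ λ a → ∑-distrib-+ (λ b → φ b * x a b) (λ b → - φ a * x a b)) ⟩
    (sum λ a → (sum λ b → φ b * x a b) + (sum λ b → - φ a * x a b))
      ≡⟨ ∑-distrib-+ (λ a → sum λ b → φ b * x a b) (λ a → sum λ b → - φ a * x a b) ⟩
    (sum λ a → sum λ b → φ b * x a b) + (sum λ a → sum λ b → - φ a * x a b)
      ≡⟨ cong₂ _+_ (∑-comm (λ a b → φ b * x a b)) refl ⟩
    (sum λ b → sum λ a → φ b * x a b) + (sum λ a → sum λ b → - φ a * x a b)
      ≡⟨ cong₂ _+_ (sum-cong-≗ λ b → sym (*-distribˡ-sum (φ b) (λ a → x a b)))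
                   (sum-cong-≗ λ a → sym (*-distribˡ-sum (- φ a) (x a))) ⟩
    (sum λ b → φ b * sum (λ a → x a b)) + (sum λ a → - φ a * sum (x a))
      ≡⟨ ∑-distrib-+ (λ b → φ b * sum (λ a → x a b)) (λ a → - φ a * sum (x a)) ⟨
    (sum λ v → φ v * sum (λ a → x a v) + - φ v * sum (x v))
      ≡⟨ (sum-cong-≗ λ v → trans (collect (φ v) _ _)
           (cong₂ (λ i o → φ v * (i - o)) (sym (length-filter-T (λ u → F (u , v)) id))
                                          (sym (length-filter-T (λ w → F (v , w)) id)))) ⟩
    (sum λ v → φ v * (pos (inDegree F v) - pos (outDegree F v))) ∎
    where
    open ≡-Reasoning
    x : Fin n → Fin n → ℤ
    x a b = ⟦ F (a , b) ⟧
    expand : ∀ x y z → x * (y - z) ≡ y * x + - z * x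
    expand = solve-∀
    collect : ∀ y i o → y * i + - y * o ≡ y * (i - o)
    collect = solve-∀

  eulerian⇒circulation≡0 : ∀ {F} → Eulerian F → ∀ φ → circulation F φ ≡ 0ℤ
  eulerian⇒circulation≡0 {F} eul φ = trans (circulation-degrees F φ)
    (trans (sum-cong-≗ λ v → trans (cong (φ v *_) (i≡j⇒i-j≡0 (cong pos (eul v)))) (*-zeroʳ (φ v)))
           (sum-replicate-zero n))

  circulation≡0⇒eulerian : ∀ {F} → (∀ φ → circulation F φ ≡ 0ℤ) → Eulerian F
  circulation≡0⇒eulerian {F} circ v = +-injective (i-j≡0⇒i≡j _ _ (begin
    imbalance v                        ≡⟨ at-v ⟩
    0ℤ + (δ v * imbalance v - 0ℤ)      ≡⟨ cong (_+ (δ v * imbalance v - 0ℤ)) (sum-replicate-zero n) ⟨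
    sum {n} (λ _ → 0ℤ) + (δ v * imbalance v - 0ℤ)
      ≡⟨ sum-update (λ u → δ u * imbalance u) (λ _ → 0ℤ) v off-v ⟨
    sum (λ u → δ u * imbalance u)      ≡⟨ circulation-degrees F δ ⟨
    circulation F δ                    ≡⟨ circ δ ⟩
    0ℤ                                 ∎))
    where
    open ≡-Reasoning
    imbalance δ : Fin n → ℤ
    imbalance u = pos (inDegree F u) - pos (outDegree F u)
    -- As a potential, the indicator of `v` isolates the imbalance at `v`.
    δ u = ⟦ does (u ≟ v) ⟧
    off-v : ∀ u → u ≢ v → δ u * imbalance u ≡ 0ℤ
    off-v u u≢v rewrite dec-false (u ≟ v) u≢v = *-zeroˡ (imbalance u)
    at-v : imbalance v ≡ 0ℤ + (δ v * imbalance v - 0ℤ)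
    at-v rewrite dec-true (v ≟ v) refl = simplify (imbalance v)
      where
      simplify : ∀ x → x ≡ 0ℤ + (1ℤ * x - 0ℤ)
      simplify = solve-∀

  circulation-update : ∀ {F F′ : Graph n} e φ → (∀ f → f ≢ e → F′ f ≡ F f) →
    circulation F′ φ ≡ circulation F φ + (⟦ F′ e ⟧ - ⟦ F e ⟧) * drop-across φ e
  circulation-update {F} {F′} (a , b) φ F′≈F = begin
    sum (row F′)
      ≡⟨ sum-update (row F′) (row F) a
           (λ a′ a′≢a → sum-cong-≗ {n} λ b′ → agree {a′} {b′} (a′≢a ∘ cong proj₁)) ⟩
    sum (row F) + (row F′ a - row F a)
      ≡⟨ cong (λ z → sum (row F) + (z - row F a))
           (sum-update (term F′ a) (term F a) b (λ b′ b′≢b → agree (b′≢b ∘ cong proj₂))) ⟩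
    sum (row F) + (row F a + (term F′ a b - term F a b) - row F a)
      ≡⟨ collect (sum (row F)) (row F a) ⟦ F′ (a , b) ⟧ ⟦ F (a , b) ⟧ (φ b - φ a) ⟩
    sum (row F) + (⟦ F′ (a , b) ⟧ - ⟦ F (a , b) ⟧) * (φ b - φ a) ∎
    where
    open ≡-Reasoning
    term : Graph n → Fin n → Fin n → ℤ
    term K a b = ⟦ K (a , b) ⟧ * (φ b - φ a)
    row : Graph n → Fin n → ℤ
    row K a = sum (term K a)
    agree : ∀ {a′ b′} → (a′ , b′) ≢ (a , b) → term F′ a′ b′ ≡ term F a′ b′
    agree {a′} {b′} ≢e = cong (λ z → ⟦ z ⟧ * (φ b′ - φ a′)) (F′≈F _ ≢e)
    collect : ∀ s t x y d → s + (t + (x * d - y * d) - t) ≡ s + (x - y) * d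
    collect = solve-∀

  -- If K ⊃ F is eulerian, then K ∖ F is a circulation all of whose edges are
  -- forward, although the rank cannot increase around a closed walk.
  eulerian∧conforms⇒maximal : ∀ {G F : Graph n} {r} →
    F ⊆ G → Eulerian F → Conforms G r F → MaximalEulerian G F
  eulerian∧conforms⇒maximal {G} {F} {r} F⊆G eulF conf = F⊆G , eulF , maximal
    where
    maximal : ¬ (∃ λ K → K ⊆ G × Eulerian K × F ⊂ K)
    maximal (K , K⊆G , eulK , F⊆K , (u , v) , uv∈K , uv∉F) =
      <-irrefl refl (<-≤-trans (gain-pos uv∈K uv∉F) gain≤0)
      where
      x : Graph n → Fin n → Fin n → ℤ
      x L a b = ⟦ L (a , b) ⟧ * drop-across r (a , b)
      gain : Fin n → Fin n → ℤ
      gain a b = x K a b + - x F a b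
      ∉⇒forward : ∀ {a b} → (a , b) ∈ K → (a , b) ∉ F → r a <ᶻ r b
      ∉⇒forward {a} {b} ∈K ∉F with r b ≤? r a
      ... | yes back = contradiction (conf _ (K⊆G _ ∈K) back) ∉F
      ... | no ¬back = ≰⇒> ¬back
      gain-pos : ∀ {a b} → (a , b) ∈ K → (a , b) ∉ F → 0ℤ <ᶻ gain a b
      gain-pos {a} {b} ∈K ∉F with K (a , b) | F (a , b) | ∈K | ∉F | ∉⇒forward ∈K ∉F
      ... | true | true  | _ | ¬tt | _     = contradiction tt ¬tt
      ... | true | false | _ | _   | ra<rb = <-by ra<rb (simplify (r a) (r b))
        where
        simplify : ∀ p q → (1ℤ * (q - p) + - (0ℤ * (q - p))) - 0ℤ ≡ q - p
        simplify = solve-∀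
      gain-nonneg : ∀ a b → 0ℤ ≤ gain a b
      gain-nonneg a b with F (a , b) in inF | K (a , b) in inK
      ... | false | false = ≤-reflexive (sym (+-inverseʳ (0ℤ * (r b - r a))))
      ... | true  | true  = ≤-reflexive (sym (+-inverseʳ (1ℤ * (r b - r a))))
      ... | true  | false =
        contradiction (F⊆K (a , b) (subst T (sym inF) tt)) (subst T inK)
      ... | false | true  = <⇒≤ (subst₂ (λ k f → 0ℤ <ᶻ ⟦ k ⟧ * (r b - r a) + - (⟦ f ⟧ * (r b - r a)))
                                        inK inF (gain-pos (subst T (sym inK) tt) (subst T inF)))
      total : sum (λ a → sum (gain a)) ≡ 0ℤ
      total = begin
        sum (λ a → sum (gain a))
          ≡⟨ (sum-cong-≗ λ a → ∑-distrib-+ (x K a) (λ b → - x F a b)) ⟩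
        sum (λ a → sum (x K a) + sum (λ b → - x F a b))
          ≡⟨ ∑-distrib-+ (λ a → sum (x K a)) (λ a → sum λ b → - x F a b) ⟩
        circulation K r + sum (λ a → sum λ b → - x F a b)
          ≡⟨ cong (circulation K r +_) neg-F ⟩
        circulation K r + - circulation F r
          ≡⟨ cong₂ (λ k f → k + - f) (eulerian⇒circulation≡0 eulK r) (eulerian⇒circulation≡0 eulF r) ⟩
        0ℤ ∎
        where
        open ≡-Reasoning
        sum-neg : ∀ {m} (f : Fin m → ℤ) → sum (λ i → - f i) ≡ - sum f
        sum-neg {zero}  f = refl
        sum-neg {suc m} f = trans (cong (- f zero +_) (sum-neg (f ∘ suc))) (sym (neg-distrib-+ (f zero) _))
        neg-F : sum (λ a → sum λ b → - x F a b) ≡ - circulation F r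
        neg-F = trans (sum-cong-≗ λ a → sum-neg (x F a)) (sum-neg (λ a → sum (x F a)))
      -- No gain is negative, so a single one is bounded by their total, which vanishes since `K`
      -- and `F` are both eulerian.
      gain≤0 : gain u v ≤ 0ℤ
      gain≤0 = ≤-trans (term≤sum (gain u) (gain-nonneg u) v)
        (≤-trans (term≤sum (λ a → sum (gain a)) (λ a → sum-nonneg (gain a) (gain-nonneg a)) u)
                 (≤-reflexive total))

-- Comparing slack maxima and slack counts.

unique-⊆⇒length-≤ : ∀ {A : Set} {xs ys : List A} → Unique xs → (∀ {x} → x ∈ˡ xs → x ∈ˡ ys) →
                    length xs ℕ.≤ length ys
unique-⊆⇒length-≤ [] _ = ℕ.z≤n
unique-⊆⇒length-≤ {xs = x ∷ xs} (x∉xs ∷ uniq) ⊆ys with ∈-∃++ (⊆ys (here refl))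
... | ys , zs , refl = subst (suc (length xs) ℕ.≤_) (sym length-middle)
  (ℕ.s≤s (unique-⊆⇒length-≤ uniq λ y∈xs → avoid y∈xs (∈-++⁻ ys (⊆ys (there y∈xs)))))
  where
  length-middle : length (ys ++ x ∷ zs) ≡ suc (length (ys ++ zs))
  length-middle = trans (length-++ ys) (trans (ℕ.+-suc (length ys) (length zs))
                    (cong suc (sym (length-++ ys))))
  avoid : ∀ {y} → y ∈ˡ xs → y ∈ˡ ys ⊎ y ∈ˡ x ∷ zs → y ∈ˡ ys ++ zs
  avoid y∈xs (inj₁ y∈ys)         = ∈-++⁺ˡ y∈ys
  avoid y∈xs (inj₂ (here refl))  = contradiction refl (All.lookup x∉xs y∈xs)
  avoid y∈xs (inj₂ (there y∈zs)) = ∈-++⁺ʳ ys y∈zs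

unique-⊂⇒length-< : ∀ {A : Set} {xs ys : List A} {y} → Unique xs →
                    (∀ {x} → x ∈ˡ xs → x ∈ˡ ys) → y ∈ˡ ys → y ∉ˡ xs → length xs < length ys
unique-⊂⇒length-< {xs = xs} {y = y} uniq xs⊆ys y∈ys y∉xs = unique-⊆⇒length-≤
  {xs = y ∷ xs} (All.tabulate (λ z∈xs y≡z → y∉xs (subst (_∈ˡ xs) (sym y≡z) z∈xs)) ∷ uniq)
  λ { (here refl) → y∈ys ; (there x∈xs) → xs⊆ys x∈xs }

module _ {n : ℕ} where

  ∈-edges⁺ : ∀ {F : Graph n} {e} → e ∈ F → e ∈ˡ edges F
  ∈-edges⁺ {F} {u , v} = ∈-filter⁺ (λ e → T? (F e)) (∈-cartesianProduct⁺ (∈-allFin u) (∈-allFin v))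

  ∈-edges⁻ : ∀ {F : Graph n} {e} → e ∈ˡ edges F → e ∈ F
  ∈-edges⁻ {F} e∈ = proj₂ (∈-filter⁻ (λ e → T? (F e)) {xs = cartesianProduct (allFin n) (allFin n)} e∈)

  module _ (H H′ : Graph n) (r r′ : Rank n) {d : Edge n} (d∈H : d ∈ H) (slack-d : 0ℤ <ᶻ slack d r)
    (improved : ∀ e → e ∈ H′ → 0ℤ <ᶻ slack e r′ → e ≢ d × e ∈ H × slack e r′ ≤ slack e r) where

    -- Edges of `H′` without slack need no counterpart in `H`, because the maximum starts from `0ℤ`.
    -- This admits the tight edges that the exchange brings in from outside `H`.
    maxSlack-≤ : maxSlack H′ r′ ≤ maxSlack H r
    maxSlack-≤ = max[xs]≤max[ys]⁺ 0ℤ (map (λ e → slack e r) (edges H)) (inj₁ ≤-refl)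
      (All.map⁺ (All.tabulate λ {e} e∈H′ → bound e (∈-edges⁻ {H′} e∈H′)))
      where
      bound : ∀ e → e ∈ H′ → slack e r′ ≤ 0ℤ ⊎ Any (slack e r′ ≤_) (map (λ e → slack e r) (edges H))
      bound e e∈H′ with 0ℤ <? slack e r′
      ... | no  s≯0 = inj₁ (≮⇒≥ s≯0)
      ... | yes s>0 with improved e e∈H′ s>0
      ...   | _ , e∈H , s≤ = inj₂ (Any.map⁺ (Any.map (λ { refl → s≤ }) (∈-edges⁺ {H} e∈H)))

    -- Every edge counted on the left is counted on the right, and `d` is counted only on the right.
    slackEdgeCount-< : slackEdgeCount H′ r′ < slackEdgeCount H r
    slackEdgeCount-< = unique-⊂⇒length-<
      (filter⁺ _ (filter⁺ _ (cartesianProduct⁺ (allFin⁺ n) (allFin⁺ n))))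
      (λ e∈ → let e∈H′ , s>0 = slacky e∈
                  _ , e∈H , s≤ = improved _ e∈H′ s>0
              in ∈-filter⁺ _ (∈-edges⁺ {H} e∈H) (<-≤-trans s>0 s≤))
      (∈-filter⁺ _ (∈-edges⁺ {H} d∈H) slack-d)
      (λ d∈ → let d∈H′ , s>0 = slacky d∈ in proj₁ (improved _ d∈H′ s>0) refl)
      where
      slacky : ∀ {e} → e ∈ˡ filter (λ e → 0ℤ <? slack e r′) (edges H′) → e ∈ H′ × 0ℤ <ᶻ slack e r′
      slacky e∈ with ∈-filter⁻ (λ e → 0ℤ <? slack e r′) {xs = edges H′} e∈
      ... | e∈H′ , s>0 = ∈-edges⁻ {H′} e∈H′ , s>0

module _ {n : ℕ} {F O : Graph n} {e : Edge n} where

  ∈-∖⁺ : e ∈ F → e ∉ O → e ∈ F ∖ O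
  ∈-∖⁺ e∈F e∉O with F e | O e
  ... | true | true  = contradiction tt e∉O
  ... | true | false = tt

  ∈-∖⁻ : e ∈ F ∖ O → e ∈ F × e ∉ O
  ∈-∖⁻ e∈ with F e | O e
  ... | true | false = tt , id

-- Arithmetic of slacks and raise requests.

slack≡ : ∀ {n} {r : Rank n} {u v} → slack (u , v) r > 0ℤ → slack (u , v) r ≡ r v - r u - 1ℤ
slack≡ {r = r} {u} {v} s>0 with ⊔-sel (r v - r u - 1ℤ) 0ℤ
... | inj₁ eq = eq
... | inj₂ eq = contradiction (subst (_> 0ℤ) eq s>0) (<-irrefl refl)

0≤slack : ∀ {n} (r : Rank n) e → 0ℤ ≤ slack e r
0≤slack r (u , v) = i≤j⊔i (r v - r u - 1ℤ) 0ℤ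

0≤gap⇒< : ∀ {x y} → 0ℤ ≤ y - x - 1ℤ → x <ᶻ y
0≤gap⇒< {x} {y} 0≤gap = suc[i]≤j⇒i<j (≤-by 0≤gap (shift x y))
  where
  shift : ∀ x y → y - (1ℤ + x) ≡ y - x - 1ℤ - 0ℤ
  shift = solve-∀

slack>0⇒forward : ∀ {n} {r : Rank n} {u v} → slack (u , v) r > 0ℤ → r u <ᶻ r v
slack>0⇒forward {r = r} s>0 = 0≤gap⇒< (<⇒≤ (subst (0ℤ <ᶻ_) (slack≡ {r = r} s>0) s>0))

slack-mono : ∀ {n} {ρ ρ′ : Rank n} {u v} → ρ v ≤ ρ′ v → ρ′ u ≤ ρ u → slack (u , v) ρ ≤ slack (u , v) ρ′
slack-mono v≤ u≥ = ⊔-monoˡ-≤ 0ℤ (+-monoˡ-≤ (- 1ℤ) (+-mono-≤ v≤ (neg-mono-≤ u≥)))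

-- Here `a` and `b` are the original ranks of tail and head of an edge outside `H`, and the tail has
-- been raised by `ℓ`. The original gap of at least one absorbs the `1ℤ` of the request.
forward-request-≤ : ∀ a b ℓ → a <ᶻ b → a + ℓ + 1ℤ - b ≤ ℓ
forward-request-≤ a b ℓ a<b = ≤-by (i<j⇒suc[i]≤j a<b) (shift a b ℓ)
  where
  shift : ∀ a b ℓ → ℓ - (a + ℓ + 1ℤ - b) ≡ b - (1ℤ + a)
  shift = solve-∀

-- The case of a head already raised by `τ`: it has moved at least as far as the tail, so nothing is
-- left to ask for.
forward-request-≤0 : ∀ a b ℓ τ → a <ᶻ b → ℓ ≤ τ → a + ℓ + 1ℤ - (b + τ) ≤ 0ℤ
forward-request-≤0 a b ℓ τ a<b ℓ≤τ = ≤-by (+-mono-≤ (i<j⇒suc[i]≤j a<b) ℓ≤τ) (shift a b ℓ τ)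
  where
  shift : ∀ a b ℓ τ → 0ℤ - (a + ℓ + 1ℤ - (b + τ)) ≡ (b + τ) - (1ℤ + a + ℓ)
  shift = solve-∀

forward-request-met : ∀ a b τ → a + 1ℤ - b ≤ τ → a <ᶻ b + τ
forward-request-met a b τ k≤τ = suc[i]≤j⇒i<j (≤-by k≤τ (shift a b τ))
  where
  shift : ∀ a b τ → b + τ - (1ℤ + a) ≡ τ - (a + 1ℤ - b)
  shift = solve-∀

-- Slack as a function of the ranks of tail and head alone. In the lemmas below the request travels
-- from head to tail, so `a` is the rank of the head and `b` that of the tail.
gap⁺ : ℤ → ℤ → ℤ
gap⁺ a b = (b - a - 1ℤ) ⊔ 0ℤ

-- Truncation at zero is 1-Lipschitz, so slack grows by at most the raise of the head.
slack-request-≤ : ∀ a b ℓ → 0ℤ ≤ ℓ → gap⁺ b (a + ℓ) - gap⁺ b a ≤ ℓ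
slack-request-≤ a b ℓ 0≤ℓ = ≤-by {x = gap⁺ b (a + ℓ)} {gap⁺ b a + ℓ}
  (⊔-lub (≤-by (i≤i⊔j (a - b - 1ℤ) 0ℤ) (shift (gap⁺ b a) a b ℓ))
         (+-mono-≤ (i≤j⊔i (a - b - 1ℤ) 0ℤ) 0≤ℓ))
  (move ℓ (gap⁺ b (a + ℓ)) (gap⁺ b a))
  where
  shift : ∀ g a b ℓ → g + ℓ - (a + ℓ - b - 1ℤ) ≡ g - (a - b - 1ℤ)
  shift = solve-∀
  move : ∀ ℓ x y → ℓ - (x - y) ≡ y + ℓ - x
  move = solve-∀

gap⁺-raise-both : ∀ a b ℓ τ → ℓ ≤ τ → gap⁺ (b + τ) (a + ℓ) ≤ gap⁺ b a
gap⁺-raise-both a b ℓ τ ℓ≤τ = ⊔-monoˡ-≤ 0ℤ (≤-by ℓ≤τ (shift a b ℓ τ))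
  where
  shift : ∀ a b ℓ τ → (a - b - 1ℤ) - (a + ℓ - (b + τ) - 1ℤ) ≡ τ - ℓ
  shift = solve-∀

-- A positive request over `g ≥ 0` means that the truncation is inactive, so granting it brings the
-- untruncated gap to exactly `g`. An equation between truncated slacks would not show that the edge
-- is forward.
slack-request-tight : ∀ a b g → 0ℤ ≤ g → 0ℤ <ᶻ gap⁺ b a - g → a - (b + (gap⁺ b a - g)) - 1ℤ ≡ g
slack-request-tight a b g 0≤g 0<k with ⊔-sel (a - b - 1ℤ) 0ℤ
... | inj₁ eq rewrite eq = cancel a b g
  where
  cancel : ∀ a b g → a - (b + (a - b - 1ℤ - g)) - 1ℤ ≡ g
  cancel = solve-∀
... | inj₂ eq rewrite eq = contradiction (<-by 0<k (shift g)) (≤⇒≯ 0≤g)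
  where
  shift : ∀ g → 0ℤ - g ≡ (0ℤ - g) - 0ℤ
  shift = solve-∀

slack-request-met : ∀ a b g τ → 0ℤ ≤ g → gap⁺ b a - g ≤ τ → gap⁺ (b + τ) a ≤ g
slack-request-met a b g τ 0≤g k≤τ = ⊔-lub
  (≤-by (+-mono-≤ (i≤i⊔j (a - b - 1ℤ) 0ℤ) k≤τ) (shift a b g τ (gap⁺ b a))) 0≤g
  where
  shift : ∀ a b g τ s → g - (a - (b + τ) - 1ℤ) ≡ (s + τ) - ((a - b - 1ℤ) + (s - g))
  shift = solve-∀

-- The priority queue and the phases of a vertex.

highest-priority : ∀ {m} (q : Fin m → Maybe ℤ) → (∀ v → q v ≡ nothing) ⊎
  ∃₂ λ u k → q u ≡ just k × (∀ v l → q v ≡ just l → l ≤ k)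
highest-priority {zero}  q = inj₁ λ ()
highest-priority {suc m} q with q zero in q₀ | highest-priority (q ∘ suc)
... | nothing | inj₁ empty = inj₁ λ { zero → q₀ ; (suc v) → empty v }
... | nothing | inj₂ (u , k , qu , top) = inj₂ (suc u , k , qu ,
  λ { zero l ql → contradiction (trans (sym q₀) ql) (λ ()) ; (suc v) l ql → top v l ql })
... | just k₀ | inj₁ empty = inj₂ (zero , k₀ , q₀ ,
  λ { zero l ql → ≤-reflexive (just-injective (trans (sym ql) q₀))
    ; (suc v) l ql → contradiction (trans (sym (empty v)) ql) (λ ()) })
... | just k₀ | inj₂ (u , k , qu , top) with ≤-total k₀ k
...   | inj₁ k₀≤k = inj₂ (suc u , k , qu ,
  λ { zero l ql → subst (_≤ k) (just-injective (trans (sym q₀) ql)) k₀≤k ; (suc v) l ql → top v l ql })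
...   | inj₂ k≤k₀ = inj₂ (zero , k₀ , q₀ ,
  λ { zero l ql → ≤-reflexive (just-injective (trans (sym ql) q₀))
    ; (suc v) l ql → ≤-trans (top v l ql) k≤k₀ })

-- In Dijkstra's terms: unreached, on the frontier, finalised. Only a waiting vertex can be popped,
-- and its rank is then still the original one.
data Status (ℓ base : ℤ) (q : Maybe ℤ) (τ ρ : ℤ) : Set where
  fresh   : q ≡ nothing → τ ≡ 0ℤ → ρ ≡ base → Status ℓ base q τ ρ
  waiting : q ≡ just τ → 0ℤ <ᶻ τ → τ ≤ ℓ → ρ ≡ base → Status ℓ base q τ ρ
  raised  : q ≡ nothing → 0ℤ <ᶻ τ → ℓ ≤ τ → ρ ≡ base + τ → Status ℓ base q τ ρ

module _ {ℓ base : ℤ} {q : Maybe ℤ} {τ ρ : ℤ} where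

  0≤increment : Status ℓ base q τ ρ → 0ℤ ≤ τ
  0≤increment (fresh _ τ≡0 _)      = ≤-reflexive (sym τ≡0)
  0≤increment (waiting _ 0<τ _ _)  = <⇒≤ 0<τ
  0≤increment (raised _ 0<τ _ _)   = <⇒≤ 0<τ

  unraised-or-raised : Status ℓ base q τ ρ → ρ ≡ base ⊎ (base <ᶻ ρ × ℓ ≤ τ × ρ ≡ base + τ)
  unraised-or-raised (fresh _ _ eq)         = inj₁ eq
  unraised-or-raised (waiting _ _ _ eq)     = inj₁ eq
  unraised-or-raised (raised _ 0<τ ℓ≤τ eq)  =
    inj₂ (subst₂ _<ᶻ_ (+-identityʳ base) (sym eq) (+-monoʳ-< base 0<τ) , ℓ≤τ , eq)

  base≤rank : Status ℓ base q τ ρ → base ≤ ρ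
  base≤rank st with unraised-or-raised st
  ... | inj₁ eq           = ≤-reflexive (sym eq)
  ... | inj₂ (b<ρ , _ , _) = <⇒≤ b<ρ

  base≤base+increment : Status ℓ base q τ ρ → base ≤ base + τ
  base≤base+increment st = subst (_≤ base + τ) (+-identityʳ base) (+-monoʳ-≤ base (0≤increment st))

  rank≤base+increment : Status ℓ base q τ ρ → ρ ≤ base + τ
  rank≤base+increment st with unraised-or-raised st
  ... | inj₁ eq          = subst (_≤ base + τ) (sym eq) (base≤base+increment st)
  ... | inj₂ (_ , _ , eq) = ≤-reflexive eq

-- Parent paths and the exchange.

module ReliefCorrectness {n : ℕ} {G H : Graph n} {r : Rank n} {p s : Fin n}
  (H⊆G : H ⊆ G) (conf : Conforms G r H) (ps∈H : (p , s) ∈ H) (ps-slack : slack (p , s) r > 0ℤ)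
  where

  open Relief H r G p s
  open State
  open DecMembership (_≟ᵉ_ {n}) using (_∈?_)

  -- Tight a b u e x: with u raised to a and x raised to b, the edge e that
  -- joins x to its parent u permits no smaller b.
  data Tight (a b : ℤ) (u : Fin n) : Edge n → Fin n → Set where
    outward : ∀ {x} → (u , x) ∈ G ∖ H → b ≡ a + 1ℤ → Tight a b u (u , x) x
    inward  : ∀ {x} → (x , u) ∈ H → a - b - 1ℤ ≡ slack (x , u) r → Tight a b u (x , u) x

  -- The interface between loop and exit: what the exchange has to know about the final ranks and
  -- parent links.
  record Settled (σ : State) : Set where
    field
      forward : ∀ e → e ∈ G ∖ H → rank σ (proj₁ e) <ᶻ rank σ (proj₂ e)
      slack-≤ : ∀ e → e ∈ H → slack e (rank σ) ≤ slack e r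
      tight   : ∀ {x u e} → parent σ x ≡ just (u , e) → Tight (rank σ u) (rank σ x) u e x

  -- A parent link uses an edge against its direction exactly when the edge lies in `H`, so the edge
  -- alone determines which endpoint was raised through it. A repeated edge thus reveals a repeated
  -- vertex.
  child : Edge n → Fin n
  child e = if H e then proj₁ e else proj₂ e

  child-tight : ∀ {a b u e x} → Tight a b u e x → child e ≡ x
  child-tight {u = u} (outward {x} ux∈ _) with H (u , x) | ∈-∖⁻ {F = G} {H} ux∈
  ... | true  | _ , ∉ = contradiction tt ∉
  ... | false | _     = refl
  child-tight {u = u} (inward {x} xu∈ _) with H (x , u)
  ... | true = refl

  symDiff : List (Edge n) → Graph n
  symDiff es = (H ∖ fromList es) ∪ (fromList es ∖ H)

  symDiff-∷-off : ∀ {e f} es → f ≢ e → symDiff (e ∷ es) f ≡ symDiff es f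
  symDiff-∷-off {e} {f} es f≢e rewrite dec-false (f ≟ᵉ e) f≢e = refl

  symDiff-∈ : ∀ {e es} → e ∈ˡ es → symDiff es e ≡ not (H e)
  symDiff-∈ {e} {es} e∈es rewrite dec-true (e ∈? es) e∈es with H e
  ... | true  = refl
  ... | false = refl

  symDiff-∉ : ∀ {e es} → e ∉ˡ es → symDiff es e ≡ H e
  symDiff-∉ {e} {es} e∉es rewrite dec-false (e ∈? es) e∉es with H e
  ... | true  = refl
  ... | false = refl

  reroute-off : ∀ {e} es → e ≢ (p , s) → reroute es e ≡ symDiff es e
  reroute-off {e} es e≢ps rewrite dec-false (e ∈? ((p , s) ∷ [])) (λ { (here eq) → e≢ps eq }) =
    ∧-identityʳ _

  ps∉reroute : ∀ es → (p , s) ∉ reroute es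
  ps∉reroute es ps∈ = proj₂ (∈-∖⁻ {F = symDiff es} {fromList ((p , s) ∷ [])} ps∈)
    (subst T (sym (dec-true ((p , s) ∈? ((p , s) ∷ [])) (here refl))) tt)

  parentPath-unique : ∀ {σ x es es′} → ParentPath σ x es → ParentPath σ x es′ → es ≡ es′
  parentPath-unique here            here               = refl
  parentPath-unique here            (step p≢p _ _)     = contradiction refl p≢p
  parentPath-unique (step p≢p _ _)  here               = contradiction refl p≢p
  parentPath-unique (step _ eq path) (step _ eq′ path′)
    with refl ← just-injective (trans (sym eq) eq′) = cong (_ ∷_) (parentPath-unique path path′)

  module _ {σ : State} (settled : Settled σ) where
    open Settled settled

    -- By determinism of the parent links, an edge occurring twice on a path
    -- would make the path equal to a proper suffix of itself.
    tail-path : ∀ {x e es} → ParentPath σ x es → e ∈ˡ es →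
                ∃ λ es′ → ParentPath σ (child e) (e ∷ es′) × length es′ < length es
    tail-path {e = e} (step {es = es} x≢p eq path) (here refl) =
      es , subst (λ y → ParentPath σ y (e ∷ es)) (sym (child-tight (tight eq))) (step x≢p eq path) , ℕ.≤-refl
    tail-path (step x≢p eq path) (there e∈es) =
      let es′ , path′ , es′<es = tail-path path e∈es in es′ , path′ , ℕ.m<n⇒m<1+n es′<es

    -- The exchange sees the path as a set, where a repeated edge would be flipped only once; the
    -- telescoping below needs every occurrence to count.
    head∉tail : ∀ {x e es} → ParentPath σ x (e ∷ es) → e ∉ˡ es
    head∉tail {e = e} (step {es = es} x≢p eq path) e∈es
      with es′ , path′ , es′<es ← tail-path path e∈es
      with refl ← parentPath-unique (subst (λ y → ParentPath σ y (e ∷ es′)) (child-tight (tight eq)) path′)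
                                    (step x≢p eq path)
      = ℕ.<-irrefl refl es′<es

    -- Adding `(u , x)` and removing `(x , u)` both change the circulation by `φ x - φ u`, and these
    -- changes telescope along the path.
    circulation-symDiff : ∀ {x es} → ParentPath σ x es → ∀ φ →
      circulation (symDiff es) φ ≡ circulation H φ + (φ x - φ p)
    circulation-symDiff here φ = trans (circulation-cong (λ e → symDiff-∉ {e} {[]} (λ ())) φ)
      (trans (sym (+-identityʳ _)) (cong (circulation H φ +_) (sym (+-inverseʳ (φ p)))))
    circulation-symDiff path@(step {x} {u} {e} {es} _ eq path′) φ = begin
      circulation (symDiff (e ∷ es)) φ
        ≡⟨ circulation-update e φ (λ f → symDiff-∷-off es) ⟩
      circulation (symDiff es) φ + (⟦ symDiff (e ∷ es) e ⟧ - ⟦ symDiff es e ⟧) * drop-across φ e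
        ≡⟨ cong₂ _+_ (circulation-symDiff path′ φ) flip-head ⟩
      circulation H φ + (φ u - φ p) + (φ x - φ u)
        ≡⟨ telescope (circulation H φ) (φ u) (φ p) (φ x) ⟩
      circulation H φ + (φ x - φ p) ∎
      where
      open ≡-Reasoning
      telescope : ∀ c a b d → c + (a - b) + (d - a) ≡ c + (d - b)
      telescope = solve-∀
      flip-value : ∀ {a b e x} → Tight a b u e x →
                   (⟦ not (H e) ⟧ - ⟦ H e ⟧) * drop-across φ e ≡ φ x - φ u
      flip-value (outward {x} ux∈ _) with H (u , x) | ∈-∖⁻ {F = G} {H} ux∈
      ... | true  | _ , ∉ = contradiction tt ∉
      ... | false | _     = *-identityˡ _
      flip-value (inward {x} xu∈ _) with H (x , u)
      ... | true = negate (φ x) (φ u)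
        where
        negate : ∀ a b → (0ℤ - 1ℤ) * (b - a) ≡ a - b
        negate = solve-∀
      flip-head : (⟦ symDiff (e ∷ es) e ⟧ - ⟦ symDiff es e ⟧) * drop-across φ e ≡ φ x - φ u
      flip-head = trans
        (cong₂ (λ i j → (⟦ i ⟧ - ⟦ j ⟧) * drop-across φ e)
          (symDiff-∈ {e} {e ∷ es} (here refl)) (symDiff-∉ (head∉tail path)))
        (flip-value (tight eq))

    -- What makes the exchange safe: an edge of `H` that it removes is forward, so conformity
    -- survives; an edge that it adds has no slack; and `(p , s)`, which is deleted separately, is
    -- not flipped as well.
    path-edge : ∀ {x e es} → ParentPath σ x es → e ∈ˡ es →
                e ≢ (p , s) × rank σ (proj₁ e) <ᶻ rank σ (proj₂ e) ×
                (e ∈ G ∖ H × slack e (rank σ) ≤ 0ℤ ⊎ e ∈ H)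
    path-edge (step _ _ path) (there e∈es) = path-edge path e∈es
    path-edge (step {u = u} x≢p eq _) (here refl) with tight eq
    ... | outward {x} ux∈ b≡a+1 =
      (λ { refl → proj₂ (∈-∖⁻ {F = G} {H} ux∈) ps∈H }) ,
      forward _ ux∈ , inj₁ (ux∈ , ⊔-lub (≤-reflexive gap≡0) ≤-refl)
      where
      cancel : ∀ a → a + 1ℤ - a - 1ℤ ≡ 0ℤ
      cancel = solve-∀
      gap≡0 : rank σ x - rank σ u - 1ℤ ≡ 0ℤ
      gap≡0 = trans (cong (λ z → z - rank σ u - 1ℤ) b≡a+1) (cancel (rank σ u))
    ... | inward xu∈ gap≡slack =
      (λ { refl → x≢p refl }) ,
      0≤gap⇒< (subst (0ℤ ≤_) (sym gap≡slack) (0≤slack r _)) , inj₂ xu∈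

    module _ {es} (path : ParentPath σ s es) (left : slack (p , s) (rank σ) > 0ℤ) where

      ∈-reroute⁻ : ∀ e → e ∈ reroute es →
                   e ≢ (p , s) × (e ∈ G ∖ H × slack e (rank σ) ≤ 0ℤ ⊎ e ∈ H)
      ∈-reroute⁻ e e∈ = e≢ps , side (e ∈? es)
        where
        e≢ps : e ≢ (p , s)
        e≢ps refl = ps∉reroute es e∈
        side : Dec (e ∈ˡ es) → e ∈ G ∖ H × slack e (rank σ) ≤ 0ℤ ⊎ e ∈ H
        side (yes e∈es) = proj₂ (proj₂ (path-edge path e∈es))
        side (no  e∉es) = inj₂ (subst T (trans (reroute-off es e≢ps) (symDiff-∉ e∉es)) e∈)

      reroute-⊆ : reroute es ⊆ G
      reroute-⊆ e e∈ with ∈-reroute⁻ e e∈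
      ... | _ , inj₁ (e∈G∖H , _) = proj₁ (∈-∖⁻ {F = G} {H} e∈G∖H)
      ... | _ , inj₂ e∈H         = H⊆G e e∈H

      reroute-eulerian : Eulerian H → Eulerian (reroute es)
      reroute-eulerian eul = circulation≡0⇒eulerian λ φ → begin
        circulation (reroute es) φ
          ≡⟨ circulation-update (p , s) φ (λ f → reroute-off es) ⟩
        circulation (symDiff es) φ + (⟦ reroute es (p , s) ⟧ - ⟦ symDiff es (p , s) ⟧) * (φ s - φ p)
          ≡⟨ cong₂ (λ c x → c + x * (φ s - φ p)) (circulation-symDiff path φ) deleted ⟩
        circulation H φ + (φ s - φ p) + (0ℤ - 1ℤ) * (φ s - φ p)
          ≡⟨ cancel (circulation H φ) (φ s - φ p) ⟩
        circulation H φ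
          ≡⟨ eulerian⇒circulation≡0 eul φ ⟩
        0ℤ ∎
        where
        open ≡-Reasoning
        cancel : ∀ c d → c + d + (0ℤ - 1ℤ) * d ≡ c
        cancel = solve-∀
        ∉⇒false : ∀ b → ¬ T b → b ≡ false
        ∉⇒false false _  = refl
        ∉⇒false true  ¬t = contradiction tt ¬t
        ∈⇒true : ∀ b → T b → b ≡ true
        ∈⇒true true _ = refl
        -- The edge `(p , s)` lies in `H` and off the path, so it is still present after the
        -- exchange, and its deletion takes away exactly `φ s - φ p`.
        deleted : ⟦ reroute es (p , s) ⟧ - ⟦ symDiff es (p , s) ⟧ ≡ 0ℤ - 1ℤ
        deleted = cong₂ (λ i j → ⟦ i ⟧ - ⟦ j ⟧) (∉⇒false _ (ps∉reroute es))
          (trans (symDiff-∉ (λ ps∈es → proj₁ (path-edge path ps∈es) refl)) (∈⇒true _ ps∈H))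

      reroute-conforms : Conforms G (rank σ) (reroute es)
      reroute-conforms e e∈G back = kept (e ≟ᵉ (p , s)) (T? (H e)) (e ∈? es)
        where
        kept : Dec (e ≡ (p , s)) → Dec (e ∈ H) → Dec (e ∈ˡ es) → e ∈ reroute es
        -- The deleted edge cannot be backward, since this exit is taken only when it has slack
        -- left.
        kept (yes refl) _ _ = contradiction (slack>0⇒forward {r = rank σ} left) (≤⇒≯ back)
        kept (no _) (no e∉H) _ = contradiction (forward e (∈-∖⁺ {F = G} {H} e∈G e∉H)) (≤⇒≯ back)
        kept (no _) (yes _) (yes e∈es) = contradiction (proj₁ (proj₂ (path-edge path e∈es))) (≤⇒≯ back)
        kept (no e≢ps) (yes e∈H) (no e∉es) =
          subst T (sym (trans (reroute-off es e≢ps) (symDiff-∉ e∉es))) e∈H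

    exit-correct : Eulerian H → ∀ {H′ r′} → Exit σ H′ r′ →
      MaximalEulerian G H′ × Conforms G r′ H′ × maxSlack H′ r′ ≤ maxSlack H r ×
      slackEdgeCount H′ r′ < slackEdgeCount H r
    exit-correct eul (noSlack ¬left) =
      eulerian∧conforms⇒maximal H⊆G eul conf′ , conf′ ,
      maxSlack-≤ H H r (rank σ) ps∈H ps-slack improved ,
      slackEdgeCount-< H H r (rank σ) ps∈H ps-slack improved
      where
      conf′ : Conforms G (rank σ) H
      conf′ e e∈G back with T? (H e)
      ... | yes e∈H = e∈H
      ... | no  e∉H = contradiction (forward e (∈-∖⁺ {F = G} {H} e∈G e∉H)) (≤⇒≯ back)
      improved : ∀ e → e ∈ H → 0ℤ <ᶻ slack e (rank σ) → e ≢ (p , s) × e ∈ H × slack e (rank σ) ≤ slack e r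
      -- With `H` unchanged, the strict drop in the count comes from `(p , s)`, whose slack has
      -- vanished.
      improved e e∈H s>0 = (λ { refl → ¬left s>0 }) , e∈H , slack-≤ e e∈H
    exit-correct eul (slackLeft {es} left path) =
      eulerian∧conforms⇒maximal (reroute-⊆ path left) (reroute-eulerian path left eul) conf′ , conf′ ,
      maxSlack-≤ H (reroute es) r (rank σ) ps∈H ps-slack improved ,
      slackEdgeCount-< H (reroute es) r (rank σ) ps∈H ps-slack improved
      where
      conf′ : Conforms G (rank σ) (reroute es)
      conf′ = reroute-conforms path left
      improved : ∀ e → e ∈ reroute es → 0ℤ <ᶻ slack e (rank σ) →
                 e ≢ (p , s) × e ∈ H × slack e (rank σ) ≤ slack e r
      improved e e∈ s>0 with ∈-reroute⁻ path left e e∈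
      ... | e≢ps , inj₂ e∈H        = e≢ps , e∈H , slack-≤ e e∈H
      ... | _    , inj₁ (_ , s≤0)  = contradiction s≤0 (<⇒≱ s>0)

  -- Invariants of the loop.

  t₀ : ℤ
  t₀ = r s - r p - 1ℤ

  0<t₀ : 0ℤ <ᶻ t₀
  0<t₀ = subst (0ℤ <ᶻ_) (slack≡ {r = r} ps-slack) ps-slack

  forward-r : ∀ {e} → e ∈ G ∖ H → r (proj₁ e) <ᶻ r (proj₂ e)
  forward-r {e} e∈ with e∈G , e∉H ← ∈-∖⁻ {F = G} {H} e∈ | r (proj₂ e) ≤? r (proj₁ e)
  ... | yes back = contradiction (conf e e∈G back) e∉H
  ... | no ¬back = ≰⇒> ¬back

  Raised : State → Fin n → Set
  Raised σ v = r v <ᶻ rank σ v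

  -- The rank that `v` reaches if no better request arrives before it is popped. Raised vertices are
  -- already there, and for unreached ones it is the original rank.
  target : State → Rank n
  target σ v = r v + t σ v

  -- ℓ separates the increments of the raised vertices from those of the
  -- queued ones, as distances do in Dijkstra's algorithm.
  record Core (ℓ : ℤ) (σ : State) : Set where
    field
      status : ∀ v → Status ℓ (r v) (queue σ v) (t σ v) (rank σ v)
      t≤t₀   : ∀ v → t σ v ≤ t₀
      source : t σ p ≡ t₀
      link   : ∀ {v u e} → parent σ v ≡ just (u , e) →
               Raised σ u × Tight (target σ u) (target σ v) u e v
      rooted : ∀ v → 0ℤ <ᶻ t σ v → v ≢ p → ∃₂ λ u e → parent σ v ≡ just (u , e)
      path   : ∀ v → Raised σ v → ∃ (ParentPath σ v)

  -- By `link`, every parent on the path is raised too, so changes to the parent links of unraised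
  -- vertices cannot reach the path.
  transport-path : ∀ {ℓ σ σ′ x es} → Core ℓ σ → (∀ y → Raised σ y → parent σ′ y ≡ parent σ y) →
                   Raised σ x → ParentPath σ x es → ParentPath σ′ x es
  transport-path core same x↑ here = here
  transport-path core same x↑ (step x≢p eq path) =
    step x≢p (trans (same _ x↑) eq) (transport-path core same (proj₁ (Core.link core eq)) path)

  record _⊑_ (σ σ′ : State) : Set where
    field
      rank-≡  : rank σ′ ≡ rank σ
      t-mono  : ∀ v → t σ v ≤ t σ′ v
      t-fixed : ∀ v → Raised σ v → t σ′ v ≡ t σ v

  ⊑-refl : ∀ {σ} → σ ⊑ σ
  ⊑-refl = record { rank-≡ = refl ; t-mono = λ _ → ≤-refl ; t-fixed = λ _ _ → refl }

  ⊑-raised : ∀ {σ σ′ v} → σ ⊑ σ′ → Raised σ v → Raised σ′ v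
  ⊑-raised {v = v} σ⊑σ′ = subst (λ ρ → r v <ᶻ ρ v) (sym (_⊑_.rank-≡ σ⊑σ′))

  ⊑-trans : ∀ {σ σ′ σ″} → σ ⊑ σ′ → σ′ ⊑ σ″ → σ ⊑ σ″
  ⊑-trans a b = record
    { rank-≡  = trans (_⊑_.rank-≡ b) (_⊑_.rank-≡ a)
    ; t-mono  = λ v → ≤-trans (_⊑_.t-mono a v) (_⊑_.t-mono b v)
    ; t-fixed = λ v v↑ → trans (_⊑_.t-fixed b v (⊑-raised a v↑)) (_⊑_.t-fixed a v v↑)
    }

  -- Both compare targets: that of a raised `u` is final and that of the other end can only grow,
  -- which keeps either condition true once it is established.
  OutRelaxed InRelaxed : State → Fin n → Fin n → Set
  OutRelaxed σ u v = target σ u <ᶻ target σ v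
  InRelaxed  σ u w = slack (w , u) (target σ) ≤ slack (w , u) r

  target-mono : ∀ {σ σ′} → σ ⊑ σ′ → ∀ v → target σ v ≤ target σ′ v
  target-mono σ⊑σ′ v = +-monoʳ-≤ (r v) (_⊑_.t-mono σ⊑σ′ v)

  target-fixed : ∀ {σ σ′ v} → σ ⊑ σ′ → Raised σ v → target σ′ v ≡ target σ v
  target-fixed {v = v} σ⊑σ′ v↑ = cong (r v +_) (_⊑_.t-fixed σ⊑σ′ v v↑)

  outRelaxed-⊑ : ∀ {σ σ′ u v} → σ ⊑ σ′ → Raised σ u → OutRelaxed σ u v → OutRelaxed σ′ u v
  outRelaxed-⊑ {v = v} σ⊑σ′ u↑ ok =
    ≤-<-trans (≤-reflexive (target-fixed σ⊑σ′ u↑)) (<-≤-trans ok (target-mono σ⊑σ′ v))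

  inRelaxed-⊑ : ∀ {σ σ′ u w} → σ ⊑ σ′ → Raised σ u → InRelaxed σ u w → InRelaxed σ′ u w
  inRelaxed-⊑ {σ} {σ′} {u} {w} σ⊑σ′ u↑ ok = ≤-trans
    (slack-mono {ρ = target σ′} {target σ} {w} {u} (≤-reflexive (target-fixed σ⊑σ′ u↑)) (target-mono σ⊑σ′ w)) ok

  record Inv (σ : State) : Set where
    field
      level      : ℤ
      core       : Core level σ
      outRelaxed : ∀ {u v} → Raised σ u → (u , v) ∈ G ∖ H → OutRelaxed σ u v
      inRelaxed  : ∀ {u w} → Raised σ u → (w , u) ∈ H → InRelaxed σ u w

  -- Scanning the edges at the popped vertex.

  module _ (ℓ : ℤ) (u : Fin n) where

    -- Until the scans are complete, edges at `u` may not be relaxed. This is what holds meanwhile,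
    -- with the level fixed at the increment of `u`.
    record Active (σ : State) : Set where
      field
        core  : Core ℓ σ
        u↑    : Raised σ u
        t-u   : t σ u ≡ ℓ

      open Core core public

      rank-u : rank σ u ≡ r u + ℓ
      rank-u with unraised-or-raised (status u)
      ... | inj₁ eq           = contradiction (subst (r u <ᶻ_) eq u↑) (<-irrefl refl)
      ... | inj₂ (_ , _ , eq) = trans eq (cong (r u +_) t-u)

      target-u : target σ u ≡ r u + ℓ
      target-u = cong (r u +_) t-u

      0≤ℓ : 0ℤ ≤ ℓ
      0≤ℓ = subst (0ℤ ≤_) t-u (0≤increment (status u))

      ℓ≤t₀ : ℓ ≤ t₀
      ℓ≤t₀ = subst (_≤ t₀) t-u (t≤t₀ u)

    -- The common contract of both scans: `k≤ℓ` keeps priorities below the level, `k≤raised` makes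
    -- an offer to a raised vertex void, and `tight` uses `r v + k` because that is the target after
    -- acceptance.
    record Request (σ : State) (e : Edge n) (v : Fin n) (k : ℤ) : Set where
      field
        k≤ℓ      : k ≤ ℓ
        k≤raised : Raised σ v → k ≤ t σ v
        tight    : t σ v <ᶻ k → Tight (target σ u) (r v + k) u e v

    record Offered (σ σ′ : State) (v : Fin n) (k : ℤ) : Set where
      field
        active : Active σ′
        grows  : σ ⊑ σ′
        k≤t    : k ≤ t σ′ v

    -- An offer is accepted only by an unraised vertex, so targets, parent links and paths of raised
    -- vertices stay as they are.
    accept : ∀ {σ e v k} → Active σ → Request σ e v k → t σ v <ᶻ k →
             ∀ {σ′} → σ′ ≡ record σ { t      = updateAt (t σ) v (const k)
                                    ; queue  = updateAt (queue σ) v (const (just k))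
                                    ; parent = updateAt (parent σ) v (const (just (u , e))) } →
             Offered σ σ′ v k
    accept {σ} {e} {v} {k} act req t<k {σ′} refl = record
      { active = record
        { core = record
          { status = status′
          ; t≤t₀   = t≤t₀′
          ; source = source′
          ; link   = link′
          ; rooted = rooted′
          ; path   = λ w w↑ → let es , path = path w w↑ in
              es , transport-path core (λ y y↑ → parent-off (raised≢v y↑)) w↑ path
          }
        ; u↑  = u↑
        ; t-u = trans (t-off (raised≢v u↑)) t-u
        }
      ; grows = record
        { rank-≡  = refl
        ; t-mono  = t-mono
        ; t-fixed = λ w w↑ → t-off (raised≢v w↑)
        }
      ; k≤t = ≤-reflexive (sym t-at)
      }
      where
      open Active act
      open Request req
      ¬v↑ : ¬ Raised σ v
      ¬v↑ v↑ = <⇒≱ t<k (k≤raised v↑)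
      raised≢v : ∀ {w} → Raised σ w → w ≢ v
      raised≢v w↑ refl = ¬v↑ w↑
      t-at : t σ′ v ≡ k
      t-at = updateAt-updates v (t σ)
      t-off : ∀ {w} → w ≢ v → t σ′ w ≡ t σ w
      t-off {w} = updateAt-minimal w v (t σ)
      queue-off : ∀ {w} → w ≢ v → queue σ′ w ≡ queue σ w
      queue-off {w} = updateAt-minimal w v (queue σ)
      parent-at : parent σ′ v ≡ just (u , e)
      parent-at = updateAt-updates v (parent σ)
      parent-off : ∀ {w} → w ≢ v → parent σ′ w ≡ parent σ w
      parent-off {w} = updateAt-minimal w v (parent σ)
      rank-v : rank σ v ≡ r v
      rank-v with unraised-or-raised (status v)
      ... | inj₁ eq           = eq
      ... | inj₂ (v↑ , _ , _) = contradiction v↑ ¬v↑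
      status′ : ∀ w → Status ℓ (r w) (queue σ′ w) (t σ′ w) (rank σ′ w)
      status′ w with w ≟ v
      ... | yes refl = waiting (trans (updateAt-updates v (queue σ)) (cong just (sym t-at)))
                               (subst (0ℤ <ᶻ_) (sym t-at) (≤-<-trans (0≤increment (status v)) t<k))
                               (subst (_≤ ℓ) (sym t-at) k≤ℓ) rank-v
      ... | no w≢v = subst₂ (λ q τ → Status ℓ (r w) q τ (rank σ w))
                            (sym (queue-off w≢v)) (sym (t-off w≢v)) (status w)
      t≤t₀′ : ∀ w → t σ′ w ≤ t₀
      t≤t₀′ w with w ≟ v
      ... | yes refl = subst (_≤ t₀) (sym t-at) (≤-trans k≤ℓ ℓ≤t₀)
      ... | no w≢v   = subst (_≤ t₀) (sym (t-off w≢v)) (t≤t₀ w)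
      source′ : t σ′ p ≡ t₀
      source′ with p ≟ v
      -- The increment of `p` is already `t₀`, which no request exceeds, so `p` never accepts an
      -- offer.
      ... | yes refl = contradiction (≤-trans k≤ℓ ℓ≤t₀) (<⇒≱ (subst (_<ᶻ k) source t<k))
      ... | no p≢v   = trans (t-off p≢v) source
      target-off : ∀ {w} → w ≢ v → target σ w ≡ target σ′ w
      target-off {w} w≢v = cong (r w +_) (sym (t-off w≢v))
      link′ : ∀ {w u′ e′} → parent σ′ w ≡ just (u′ , e′) →
              Raised σ u′ × Tight (target σ′ u′) (target σ′ w) u′ e′ w
      link′ {w} {u′} {e′} eq with w ≟ v
      ... | yes refl with refl ← just-injective (trans (sym parent-at) eq) =
        u↑ , subst₂ (λ a b → Tight a b u e v) (target-off (raised≢v u↑)) (cong (r v +_) (sym t-at)) (tight t<k)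
      ... | no w≢v with u′↑ , tight′ ← link (trans (sym (parent-off w≢v)) eq) =
        u′↑ , subst₂ (λ a b → Tight a b u′ e′ w) (target-off (raised≢v u′↑)) (target-off w≢v) tight′
      rooted′ : ∀ w → 0ℤ <ᶻ t σ′ w → w ≢ p → ∃₂ λ u′ e′ → parent σ′ w ≡ just (u′ , e′)
      rooted′ w 0<t w≢p with w ≟ v
      ... | yes refl = u , e , parent-at
      ... | no w≢v with u′ , e′ , eq ← rooted w (subst (0ℤ <ᶻ_) (t-off w≢v) 0<t) w≢p =
        u′ , e′ , trans (parent-off w≢v) eq
      t-mono : ∀ w → t σ w ≤ t σ′ w
      t-mono w with w ≟ v
      ... | yes refl = subst (t σ v ≤_) (sym t-at) (<⇒≤ t<k)
      ... | no w≢v   = ≤-reflexive (sym (t-off w≢v))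

    offer-offered : ∀ {σ e v k} → Active σ → Request σ e v k → Offered σ (offer u e v k σ) v k
    offer-offered {σ} {e} {v} {k} act req with t σ v <? k
    ... | yes t<k = accept act req t<k refl
    ... | no  t≮k = record { active = act ; grows = ⊑-refl ; k≤t = ≮⇒≥ t≮k }

    record Scanned (σ σ′ : State) (Q : State → Set) : Set where
      field
        active  : Active σ′
        grows   : σ ⊑ σ′
        relaxed : Q σ′

    scanOut-scanned : ∀ {σ v} → Active σ → (u , v) ∈ G ∖ H →
                      Scanned σ (scanOut u σ v) (λ σ′ → OutRelaxed σ′ u v)
    scanOut-scanned {σ} {v} act uv∈ = record
      { active  = Offered.active offered
      ; grows   = Offered.grows offered
      ; relaxed = relaxed
      }
      where
      open Active act
      k : ℤ
      k = rank σ u + 1ℤ - rank σ v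
      ru<rv : r u <ᶻ r v
      ru<rv = forward-r uv∈
      unraised-k : rank σ v ≡ r v → k ≡ r u + ℓ + 1ℤ - r v
      unraised-k = cong₂ (λ a b → a + 1ℤ - b) rank-u
      raised-k≤0 : ℓ ≤ t σ v → rank σ v ≡ r v + t σ v → k ≤ 0ℤ
      raised-k≤0 ℓ≤t eq = subst (_≤ 0ℤ) (sym (cong₂ (λ a b → a + 1ℤ - b) rank-u eq))
        (forward-request-≤0 (r u) (r v) ℓ (t σ v) ru<rv ℓ≤t)
      request : Request σ (u , v) v k
      request with unraised-or-raised (status v)
      ... | inj₁ eq = record
        { k≤ℓ      = subst (_≤ ℓ) (sym (unraised-k eq)) (forward-request-≤ (r u) (r v) ℓ ru<rv)
        ; k≤raised = λ v↑ → contradiction (subst (r v <ᶻ_) eq v↑) (<-irrefl refl)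
        ; tight    = λ _ → outward uv∈ (trans (cong (r v +_) (unraised-k eq))
                       (trans (cancel (r u) (r v) ℓ) (cong (_+ 1ℤ) (sym target-u))))
        }
        where
        cancel : ∀ a b ℓ → b + (a + ℓ + 1ℤ - b) ≡ a + ℓ + 1ℤ
        cancel = solve-∀
      -- A raised head has moved by at least `ℓ`, so the request is not positive and will be
      -- refused.
      ... | inj₂ (_ , ℓ≤t , eq) = record
        { k≤ℓ      = ≤-trans (raised-k≤0 ℓ≤t eq) 0≤ℓ
        ; k≤raised = λ _ → k≤t
        ; tight    = λ t<k → contradiction k≤t (<⇒≱ t<k)
        }
        where
        k≤t : k ≤ t σ v
        k≤t = ≤-trans (raised-k≤0 ℓ≤t eq) (0≤increment (status v))
      offered : Offered σ (scanOut u σ v) v k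
      offered = offer-offered act request
      relaxed : OutRelaxed (scanOut u σ v) u v
      relaxed with unraised-or-raised (status v)
      ... | inj₁ eq = ≤-<-trans (≤-reflexive (Active.target-u (Offered.active offered)))
        (forward-request-met (r u + ℓ) (r v) _ (subst (_≤ t (scanOut u σ v) v) (unraised-k eq) (Offered.k≤t offered)))
      ... | inj₂ (_ , ℓ≤t , eq) = outRelaxed-⊑ (Offered.grows offered) u↑
        (subst (_<ᶻ r v + t σ v) (sym target-u) (+-mono-<-≤ ru<rv ℓ≤t))

    scanIn-scanned : ∀ {σ w} → Active σ → (w , u) ∈ H →
                     Scanned σ (scanIn u σ w) (λ σ′ → InRelaxed σ′ u w)
    scanIn-scanned {σ} {w} act wu∈ = record
      { active  = Offered.active offered
      ; grows   = Offered.grows offered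
      ; relaxed = relaxed
      }
      where
      open Active act
      k : ℤ
      k = slack (w , u) (rank σ) - slack (w , u) r
      unraised-k : rank σ w ≡ r w → k ≡ gap⁺ (r w) (r u + ℓ) - slack (w , u) r
      unraised-k eq = cong₂ (λ a b → gap⁺ b a - slack (w , u) r) rank-u eq
      raised-slack : ℓ ≤ t σ w → rank σ w ≡ r w + t σ w → slack (w , u) (rank σ) ≤ slack (w , u) r
      raised-slack ℓ≤t eq = subst (_≤ slack (w , u) r) (sym (cong₂ (λ a b → gap⁺ b a) rank-u eq))
        (gap⁺-raise-both (r u) (r w) ℓ (t σ w) ℓ≤t)
      request : Request σ (w , u) w k
      request with unraised-or-raised (status w)
      ... | inj₁ eq = record
        { k≤ℓ      = subst (_≤ ℓ) (sym (unraised-k eq)) (slack-request-≤ (r u) (r w) ℓ 0≤ℓ)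
        ; k≤raised = λ w↑ → contradiction (subst (r w <ᶻ_) eq w↑) (<-irrefl refl)
        ; tight    = λ t<k → inward wu∈ (trans
            (cong₂ (λ a k → a - (r w + k) - 1ℤ) target-u (unraised-k eq))
            (slack-request-tight (r u + ℓ) (r w) (slack (w , u) r) (0≤slack r (w , u))
              (subst (0ℤ <ᶻ_) (unraised-k eq) (≤-<-trans (0≤increment (status w)) t<k))))
        }
      ... | inj₂ (_ , ℓ≤t , eq) = record
        { k≤ℓ      = ≤-trans k≤0 0≤ℓ
        ; k≤raised = λ _ → k≤t
        ; tight    = λ t<k → contradiction k≤t (<⇒≱ t<k)
        }
        where
        k≤0 : k ≤ 0ℤ
        k≤0 = i≤j⇒i-j≤0 (raised-slack ℓ≤t eq)
        k≤t : k ≤ t σ w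
        k≤t = ≤-trans k≤0 (0≤increment (status w))
      offered : Offered σ (scanIn u σ w) w k
      offered = offer-offered act request
      relaxed : InRelaxed (scanIn u σ w) u w
      relaxed with unraised-or-raised (status w)
      ... | inj₁ eq = subst (λ a → gap⁺ (target (scanIn u σ w) w) a ≤ slack (w , u) r)
        (sym (Active.target-u (Offered.active offered)))
        (slack-request-met (r u + ℓ) (r w) (slack (w , u) r) _ (0≤slack r (w , u))
          (subst (_≤ t (scanIn u σ w) w) (unraised-k eq) (Offered.k≤t offered)))
      ... | inj₂ (_ , ℓ≤t , eq) = inRelaxed-⊑ (Offered.grows offered) u↑
        (subst (λ a → gap⁺ (target σ w) a ≤ slack (w , u) r) (sym target-u)
          (gap⁺-raise-both (r u) (r w) ℓ (t σ w) ℓ≤t))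

    -- `stable` carries the outcome of each scan through all later ones, so the order of `xs` is
    -- immaterial.
    foldl-scanned : (scan : State → Fin n → State) (P : Fin n → Set) (Q : Fin n → State → Set) →
      (∀ {σ σ′ x} → σ ⊑ σ′ → Raised σ u → Q x σ → Q x σ′) →
      (∀ {σ x} → Active σ → P x → Scanned σ (scan σ x) (Q x)) →
      ∀ {σ} xs → Active σ → (∀ {x} → x ∈ˡ xs → P x) →
      Scanned σ (foldl scan σ xs) (λ σ′ → ∀ {x} → x ∈ˡ xs → Q x σ′)
    foldl-scanned scan P Q stable scanned [] act all =
      record { active = act ; grows = ⊑-refl ; relaxed = λ () }
    foldl-scanned scan P Q stable scanned (x ∷ xs) act all = record
      { active  = Scanned.active rest
      ; grows   = ⊑-trans (Scanned.grows first) (Scanned.grows rest)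
      ; relaxed = λ { (here refl) → stable (Scanned.grows rest) (Active.u↑ (Scanned.active first)) (Scanned.relaxed first)
                    ; (there y∈xs) → Scanned.relaxed rest y∈xs }
      }
      where
      first = scanned act (all (here refl))
      rest  = foldl-scanned scan P Q stable scanned xs (Scanned.active first) (all ∘ there)

  -- One iteration of the loop.

  popRaise-active : ∀ {σ u k} → Inv σ → queue σ u ≡ just k → (∀ v l → queue σ v ≡ just l → l ≤ k) →
                    Active k u (popRaise u σ) × rank σ u ≡ r u
  popRaise-active {σ} {u} {k} inv queued highest with Core.status (Inv.core inv) u
  ... | fresh empty _ _    = contradiction (trans (sym queued) empty) (λ ())
  ... | raised empty _ _ _ = contradiction (trans (sym queued) empty) (λ ())
  ... | waiting queued′ 0<t t≤ℓ rank-u with refl ← just-injective (trans (sym queued′) queued) = record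
    { core = record
      { status = status′
      ; t≤t₀   = t≤t₀
      ; source = source
      ; link   = λ eq → let w↑ , tight = link eq in still-raised w↑ , tight
      ; rooted = rooted
      ; path   = path′
      }
    ; u↑  = u↑
    ; t-u = refl
    } , rank-u
    where
    open Inv inv using (core)
    open Core core
    σ′ : State
    σ′ = popRaise u σ
    rank-at : rank σ′ u ≡ r u + t σ u
    rank-at = trans (updateAt-updates u (rank σ)) (cong (_+ t σ u) rank-u)
    rank-off : ∀ {w} → w ≢ u → rank σ′ w ≡ rank σ w
    rank-off {w} = updateAt-minimal w u (rank σ)
    queue-off : ∀ {w} → w ≢ u → queue σ′ w ≡ queue σ w
    queue-off {w} = updateAt-minimal w u (queue σ)
    u↑ : Raised σ′ u
    u↑ = subst₂ _<ᶻ_ (+-identityʳ (r u)) (sym rank-at) (+-monoʳ-< (r u) 0<t)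
    still-raised : ∀ {w} → Raised σ w → Raised σ′ w
    still-raised {w} w↑ with w ≟ u
    ... | yes refl = u↑
    ... | no w≢u   = subst (r w <ᶻ_) (sym (rank-off w≢u)) w↑
    -- The level drops to `t σ u`. It still bounds the waiting priorities because `u` had the
    -- highest one, and it still lies below the raised increments because it is at most the old
    -- level.
    relevel : ∀ w → Status _ (r w) (queue σ w) (t σ w) (rank σ w) →
              Status (t σ u) (r w) (queue σ w) (t σ w) (rank σ w)
    relevel w (fresh q τ ρ)          = fresh q τ ρ
    relevel w (waiting q 0<τ _ ρ)    = waiting q 0<τ (highest w _ q) ρ
    relevel w (raised q 0<τ ℓ≤τ ρ)   = raised q 0<τ (≤-trans t≤ℓ ℓ≤τ) ρ
    status′ : ∀ w → Status (t σ u) (r w) (queue σ′ w) (t σ w) (rank σ′ w)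
    status′ w with w ≟ u
    ... | yes refl = raised (updateAt-updates u (queue σ)) 0<t ≤-refl rank-at
    ... | no w≢u   = subst₂ (λ q ρ → Status (t σ u) (r w) q (t σ w) ρ)
                            (sym (queue-off w≢u)) (sym (rank-off w≢u)) (relevel w (status w))
    old-path : ∀ {w} → Raised σ w → ∃ (ParentPath σ′ w)
    old-path {w} w↑ with es , route ← path w w↑ = es , transport-path core (λ _ _ → refl) w↑ route
    path′ : ∀ w → Raised σ′ w → ∃ (ParentPath σ′ w)
    path′ w w↑ with w ≟ u | w ≟ p
    ... | no w≢u   | _        = old-path (subst (r w <ᶻ_) (rank-off w≢u) w↑)
    ... | yes refl | yes refl = [] , here
    -- The parent of `u` was raised before `u`, so it already has a path, to which one step is
    -- added. Following parent links from a raised vertex therefore never cycles.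
    ... | yes refl | no u≢p with x , e , eq ← rooted u 0<t u≢p
                            with es , route ← old-path (proj₁ (link eq)) = e ∷ es , step u≢p eq route

  -- Its length is the termination measure: each pop takes one vertex off, and raised vertices stay
  -- raised.
  unraised : State → List (Fin n)
  unraised σ = filter (λ v → rank σ v ≤? r v) (allFin n)

  step-correct : ∀ {σ σ′} → σ ⟶ σ′ → Inv σ → Inv σ′ × length (unraised σ′) < length (unraised σ)
  step-correct {σ} (pop u k queued highest vs ws vs↭ ws↭) inv =
    record { level = k ; core = Active.core act₃ ; outRelaxed = outRelaxed′ ; inRelaxed = inRelaxed′ } ,
    unique-⊂⇒length-< (filter⁺ _ (allFin⁺ n))
      (λ {x} x∈ → ∈-filter⁺ _ (∈-allFin x)
        (≮⇒≥ λ x↑ → ≤⇒≯ (proj₂ (∈-filter⁻ (λ v → rank σ₃ v ≤? r v) {xs = allFin n} x∈)) (still-raised x↑)))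
      (∈-filter⁺ _ (∈-allFin u) (≤-reflexive rank-u))
      (λ u∈ → ≤⇒≯ (proj₂ (∈-filter⁻ (λ v → rank σ₃ v ≤? r v) {xs = allFin n} u∈)) (Active.u↑ act₃))
    where
    open Inv inv
    σ₁ σ₂ σ₃ : State
    σ₁ = popRaise u σ
    σ₂ = foldl (scanOut u) σ₁ vs
    σ₃ = foldl (scanIn u) σ₂ ws
    act₁ : Active k u σ₁
    act₁ = proj₁ (popRaise-active inv queued highest)
    rank-u : rank σ u ≡ r u
    rank-u = proj₂ (popRaise-active inv queued highest)
    outs : Scanned k u σ₁ σ₂ (λ σ′ → ∀ {v} → v ∈ˡ vs → OutRelaxed σ′ u v)
    outs = foldl-scanned k u (scanOut u) (λ v → (u , v) ∈ G ∖ H) (λ v σ′ → OutRelaxed σ′ u v)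
      outRelaxed-⊑ (scanOut-scanned k u) vs act₁
      (λ v∈ → proj₁ (proj₂ (∈-filter⁻ (λ v → T? ((G ∖ H) (u , v)) ×-dec (rank σ₁ v ≤? rank σ₁ u))
                                      {xs = allFin n} (∈-resp-↭ vs↭ v∈))))
    ins : Scanned k u σ₂ σ₃ (λ σ′ → ∀ {w} → w ∈ˡ ws → InRelaxed σ′ u w)
    ins = foldl-scanned k u (scanIn u) (λ w → (w , u) ∈ H) (λ w σ′ → InRelaxed σ′ u w)
      inRelaxed-⊑ (scanIn-scanned k u) ws (Scanned.active outs)
      (λ w∈ → proj₁ (proj₂ (∈-filter⁻ (λ w → T? (H (w , u)) ×-dec (slack (w , u) r <? slack (w , u) (rank σ₁)))
                                      {xs = allFin n} (∈-resp-↭ ws↭ w∈))))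
    act₃ : Active k u σ₃
    act₃ = Scanned.active ins
    σ₁⊑σ₃ : σ₁ ⊑ σ₃
    σ₁⊑σ₃ = ⊑-trans (Scanned.grows outs) (Scanned.grows ins)
    open Active act₁ using (status; u↑) renaming (rank-u to rank₁-u; target-u to target₁-u)
    rank₁≤target₁ : ∀ v → rank σ₁ v ≤ target σ₁ v
    rank₁≤target₁ v = rank≤base+increment (status v)
    rank₁≡target₁ : rank σ₁ u ≡ target σ₁ u
    rank₁≡target₁ = trans rank₁-u (sym target₁-u)
    raised₁ : ∀ {v} → v ≢ u → Raised σ₃ v → Raised σ v × Raised σ₁ v
    raised₁ {v} v≢u v↑ = subst (r v <ᶻ_) (updateAt-minimal v u (rank σ) v≢u) v↑₁ , v↑₁
      where
      v↑₁ : Raised σ₁ v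
      v↑₁ = subst (λ ρ → r v <ᶻ ρ v) (_⊑_.rank-≡ σ₁⊑σ₃) v↑
    still-raised : ∀ {v} → Raised σ v → Raised σ₃ v
    still-raised {v} v↑ with v ≟ u
    ... | yes refl = Active.u↑ act₃
    ... | no v≢u   = ⊑-raised σ₁⊑σ₃ (subst (r v <ᶻ_) (sym (updateAt-minimal v u (rank σ) v≢u)) v↑)
    outRelaxed-u : ∀ {v} → (u , v) ∈ G ∖ H → OutRelaxed σ₃ u v
    outRelaxed-u {v} uv∈ with rank σ₁ v ≤? rank σ₁ u
    ... | yes violated = outRelaxed-⊑ (Scanned.grows ins) (Active.u↑ (Scanned.active outs))
      (Scanned.relaxed outs (∈-resp-↭ (↭-sym vs↭) (∈-filter⁺ _ (∈-allFin v) (uv∈ , violated))))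
    -- An edge that is not violated is never scanned. It is relaxed nevertheless: `u` is at its
    -- target already, and the head's target is at least its current rank.
    ... | no ¬violated = outRelaxed-⊑ σ₁⊑σ₃ u↑
      (<-≤-trans (subst (_<ᶻ rank σ₁ v) rank₁≡target₁ (≰⇒> ¬violated)) (rank₁≤target₁ v))
    inRelaxed-u : ∀ {w} → (w , u) ∈ H → InRelaxed σ₃ u w
    inRelaxed-u {w} wu∈ with slack (w , u) r <? slack (w , u) (rank σ₁)
    ... | yes violated = Scanned.relaxed ins
      (∈-resp-↭ (↭-sym ws↭) (∈-filter⁺ _ (∈-allFin w) (wu∈ , violated)))
    ... | no ¬violated = inRelaxed-⊑ σ₁⊑σ₃ u↑ (≤-trans
      (slack-mono {ρ = target σ₁} {rank σ₁} {w} {u} (≤-reflexive (sym rank₁≡target₁)) (rank₁≤target₁ w))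
      (≮⇒≥ ¬violated))
    outRelaxed′ : ∀ {x v} → Raised σ₃ x → (x , v) ∈ G ∖ H → OutRelaxed σ₃ x v
    outRelaxed′ {x} x↑ xv∈ with x ≟ u
    ... | yes refl = outRelaxed-u xv∈
    ... | no x≢u with x↑₀ , x↑₁ ← raised₁ x≢u x↑ = outRelaxed-⊑ σ₁⊑σ₃ x↑₁ (outRelaxed x↑₀ xv∈)
    inRelaxed′ : ∀ {x w} → Raised σ₃ x → (w , x) ∈ H → InRelaxed σ₃ x w
    inRelaxed′ {x} x↑ wx∈ with x ≟ u
    ... | yes refl = inRelaxed-u wx∈
    ... | no x≢u with x↑₀ , x↑₁ ← raised₁ x≢u x↑ = inRelaxed-⊑ σ₁⊑σ₃ x↑₁ (inRelaxed x↑₀ wx∈)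

  -- Complete runs, termination and the output.

  init-inv : Inv init
  init-inv = record
    { level = t₀
    ; core = record
      { status = status
      ; t≤t₀   = t≤t₀
      ; source = updateAt-updates p _
      ; link   = λ ()
      ; rooted = λ v 0<t v≢p → contradiction (subst (0ℤ <ᶻ_) (updateAt-minimal v p _ v≢p) 0<t) (<-irrefl refl)
      ; path   = λ v v↑ → contradiction v↑ (<-irrefl refl)
      }
    ; outRelaxed = λ v↑ → contradiction v↑ (<-irrefl refl)
    ; inRelaxed  = λ v↑ → contradiction v↑ (<-irrefl refl)
    }
    where
    status : ∀ v → Status t₀ (r v) (queue init v) (t init v) (r v)
    status v with v ≟ p
    ... | no v≢p   = fresh (updateAt-minimal v p _ v≢p) (updateAt-minimal v p _ v≢p) refl
    ... | yes refl = waiting (trans (updateAt-updates p _) (cong just (sym t-p)))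
                             (subst (0ℤ <ᶻ_) (sym t-p) 0<t₀) (≤-reflexive t-p) refl
      where
      t-p : t init p ≡ t₀
      t-p = updateAt-updates p _
    t≤t₀ : ∀ v → t init v ≤ t₀
    t≤t₀ v with v ≟ p
    ... | no v≢p   = subst (_≤ t₀) (sym (updateAt-minimal v p _ v≢p)) (<⇒≤ 0<t₀)
    ... | yes refl = ≤-reflexive (updateAt-updates p _)

  inv-run : ∀ {σ σ′} → σ ⟶* σ′ → Inv σ → Inv σ′
  inv-run ε inv = inv
  inv-run (step₁ ◅ steps) inv = inv-run steps (proj₁ (step-correct step₁ inv))

  inv-accessible : ∀ {σ} → Inv σ → Acc _<_ (length (unraised σ)) → Acc (flip _⟶_) σ
  inv-accessible inv (acc rec) = acc λ step₁ →
    let inv′ , fewer = step-correct step₁ inv in inv-accessible inv′ (rec fewer)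

  module _ {σ : State} (inv : Inv σ) (finished : Finished σ) where
    open Inv inv
    open Core core

    rank≡target : ∀ v → rank σ v ≡ target σ v
    rank≡target v with status v
    ... | fresh _ t≡0 eq    = trans eq (sym (trans (cong (r v +_) t≡0) (+-identityʳ (r v))))
    ... | waiting q _ _ _   = contradiction (trans (sym (finished v)) q) (λ ())
    ... | raised _ _ _ eq   = eq

    finished-settled : Settled σ
    finished-settled = record
      { forward = λ (u , v) → forward u v
      ; slack-≤ = λ (w , u) → slack-≤ w u
      ; tight   = λ {x} {u} {e} eq → subst₂ (λ a b → Tight a b u e x)
          (sym (rank≡target u)) (sym (rank≡target x)) (proj₂ (link eq))
      }
      where
      forward : ∀ u v → (u , v) ∈ G ∖ H → rank σ u <ᶻ rank σ v
      forward u v uv∈ with unraised-or-raised (status u)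
      ... | inj₂ (u↑ , _ , _) = subst₂ _<ᶻ_ (sym (rank≡target u)) (sym (rank≡target v)) (outRelaxed u↑ uv∈)
      -- An unraised tail keeps its original rank and the head never sinks, so the edge stays
      -- forward as under `r`.
      ... | inj₁ eq = <-≤-trans (subst (_<ᶻ r v) (sym eq) (forward-r uv∈)) (base≤rank (status v))
      slack-≤ : ∀ w u → (w , u) ∈ H → slack (w , u) (rank σ) ≤ slack (w , u) r
      slack-≤ w u wu∈ with unraised-or-raised (status u)
      ... | inj₂ (u↑ , _ , _) = ≤-trans
        (slack-mono {ρ = rank σ} {target σ} {w} {u} (≤-reflexive (rank≡target u)) (≤-reflexive (sym (rank≡target w))))
        (inRelaxed u↑ wu∈)
      ... | inj₁ eq = slack-mono {ρ = rank σ} {r} {w} {u} (≤-reflexive eq) (base≤rank (status w))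

    finished-exit : ∃₂ (Exit σ)
    finished-exit with 0ℤ <? slack (p , s) (rank σ)
    ... | no  ¬left = H , rank σ , noSlack ¬left
    ... | yes left  = _ , rank σ , slackLeft left (proj₂ (path s s↑))
      where
      cancel : ∀ a b → a - (b + (a - b - 1ℤ)) - 1ℤ ≡ 0ℤ
      cancel = solve-∀
      s↑ : Raised σ s
      s↑ with unraised-or-raised (status s)
      ... | inj₂ (s↑ , _ , _) = s↑
      -- Raising `p` by `t₀` closes the gap exactly if `s` stays in place, so remaining slack means
      -- that `s` was raised and has a path.
      ... | inj₁ eq = contradiction (subst (0ℤ <ᶻ_) slack≡0 left) (<-irrefl refl)
        where
        rank-p : rank σ p ≡ r p + t₀
        rank-p = trans (rank≡target p) (cong (r p +_) source)
        slack≡0 : slack (p , s) (rank σ) ≡ 0ℤ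
        slack≡0 = trans (slack≡ {r = rank σ} left)
          (trans (cong₂ (λ a b → a - b - 1ℤ) eq rank-p) (cancel (r s) (r p)))

  inv-output : ∀ {σ} → Inv σ → Acc _<_ (length (unraised σ)) → ∃₂ (OutputFrom σ)
  inv-output {σ} inv (acc rec) with highest-priority (queue σ)
  ... | inj₁ finished with H′ , r′ , exit ← finished-exit inv finished = H′ , r′ , σ , ε , finished , exit
  ... | inj₂ (u , k , queued , highest)
    with step₁ ← pop {σ} u k queued highest _ _ ↭-refl ↭-refl
    with inv′ , fewer ← step-correct step₁ inv
    with H′ , r′ , σ′ , steps , rest ← inv-output inv′ (rec fewer) = H′ , r′ , σ′ , step₁ ◅ steps , rest

  terminates : Terminates
  terminates = inv-accessible init-inv (<-wellFounded _) ,
    λ σ run → inv-output (inv-run run init-inv) (<-wellFounded _)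

  output-correct : Eulerian H → ∀ H′ r′ → Output H′ r′ →
    MaximalEulerian G H′ × Conforms G r′ H′ × maxSlack H′ r′ ≤ maxSlack H r ×
    slackEdgeCount H′ r′ < slackEdgeCount H r
  output-correct eul H′ r′ (σ , run , finished , exit) =
    exit-correct (finished-settled (inv-run run init-inv) finished) eul exit

proposition3 : ∀ {n : ℕ} (G H : Graph n) (r : Rank n) →
    MaximalEulerian G H → Conforms G r H →
    (p s : Fin n) → (p , s) ∈ H → slack (p , s) r > 0ℤ →
    Relief.Terminates H r G p s ×
    (∀ (H′ : Graph n) (r′ : Rank n) → Relief.Output H r G p s H′ r′ →
    MaximalEulerian G H′ ×
    Conforms G r′ H′ ×
    maxSlack H′ r′ ≤ maxSlack H r ×
    slackEdgeCount H′ r′ < slackEdgeCount H r)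
proposition3 G H r (H⊆G , eulerian , _) conf p s ps∈H ps-slack =
  terminates , output-correct eulerian
  where open ReliefCorrectness {G = G} H⊆G conf ps∈H ps-slack
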